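{- The ALT-algorithm may require $\Omega(\frac{1}{\epsilon^2})$ rounds in order to return a $(1-\epsilon)$-approximation to a maximum matching, with or without the freezing mechanism, already on path graphs: there are absolute constants $C>0$ and $\epsilon_0>0$ such that for every $\epsilon$ with $0<\epsilon\le\epsilon_0$ there is an integer $x\ge2$ such that, for the path graph on $6x-2$ vertices (with bipartition $A,B$ as in the context) and for each of the two versions of the ALT-algorithm (without freezing, and with freezing with parameter $\epsilon$), there is an execution (i.e. a valid choice of the maximal matchings $N_1,N_2,\ldots$) in which, for every integer $r$ with $0\le r\le C/\epsilon^2$, the matching $M$ held after $r$ rounds satisfies $|M|<(1-\epsilon)|OPT|$, where $OPT$ is a maximum matching of the graph.
   Context: A matching is a set of pairwise vertex-disjoint edges; it is maximal (in a graph) if no edge of the graph can be added to it, and maximum if it has the largest possible size. For a matching $N$, $A(N)$ and $B(N)$ denote the sets of $A$-vertices and $B$-vertices incident to edges of $N$. $\Gamma(v)$ denotes the neighbourhood of $v$ in $G$. ALT-algorithm on a bipartite graph $G=(A,B,E)$, run here for as many rounds as desired: Initialize $M=\varnothing$ and $c(b)=0$ for all $b\in B$. In each round $r=1,2,\ldots$: (i) for every $a\in A\setminus A(M)$ let $c_{\min}(a):=\min\{c(b): b\in\Gamma(a)\}$; (ii) let $H_r\subseteq G$ be the subgraph spanned by all edges $ab\in E$ with $a\in A\setminus A(M)$, $b\in B$ and $c(b)=c_{\min}(a)$ [version without freezing], respectively $c(b)=c_{\min}(a)$ and $c(b)\le\frac{3}{\epsilon}$ [version with freezing mechanism, parameter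 $\epsilon$]; (iii) compute an arbitrary maximal matching $N_r$ in $H_r$; (iv) set $M\gets\{ab\in M: b\notin B(N_r)\}\cup N_r$; (v) increase $c(b)$ by $1$ for each $b\in B(N_r)$. An execution is determined by the choices of the maximal matchings $N_r$. Path graph on $6x-2$ vertices: $A=\{a_0,\ldots,a_{3x-2}\}$, $B=\{b_0,\ldots,b_{3x-2}\}$, where $a_i$ is adjacent to $b_i$ and $b_{i+1}$ for $0\le i\le 3x-3$, and $a_{3x-2}$ is adjacent only to $b_{3x-2}$. -}

module Defs where

open import Level using (0ℓ)
open import Function using (_∘_)
open import Algebra.Bundles using (CommutativeMonoid)
import Algebra.Properties.CommutativeSemigroup as CommutativeSemigroupProperties
open import Data.Nat using (ℕ; zero; suc; _∸_)
import Data.Nat as ℕ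
import Data.Nat.Properties as ℕₚ
open import Data.Integer using (+_)
open import Data.Rational as ℚ
  using (ℚ; 0ℚ; 1ℚ; ½; 1/_; ∣_∣; Positive)
import Data.Rational.Properties as ℚₚ
open import Data.Fin using (Fin; toℕ)
open import Data.Fin.Properties using (_≟_)
open import Data.Bool using (if_then_else_)
open import Data.List using (List; []; _∷_; _++_; map; filter; length)
open import Data.List.Relation.Unary.All using (All)
open import Data.List.Relation.Unary.AllPairs using (AllPairs)
open import Data.List.Membership.Propositional using (_∉_)
import Data.List.Membership.DecPropositional as DecMembership
open import Data.Product using (Σ; ∃; _×_; _,_; proj₁; proj₂; uncurry)
open import Data.Sum using (_⊎_)
open import Data.Unit using (⊤)
open import Relation.Binary using (REL)
open import Relation.Binary.PropositionalEquality
  using (_≡_; _≢_; sym; trans; cong; cong₂; subst)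
open import Relation.Nullary using (¬_; ¬?; does)

-- Equality of reals is never needed, so no equivalence is put on the sequences.

Cauchy : (ℕ → ℚ) → Set
Cauchy s = ∀ δ → 0ℚ ℚ.< δ →
  ∃ λ N → ∀ m n → N ℕ.≤ m → N ℕ.≤ n → ∣ s m ℚ.- s n ∣ ℚ.≤ δ

record ℝ : Set where
  constructor mkℝ
  field
    seq    : ℕ → ℚ
    cauchy : Cauchy seq

open ℝ public

infix 4 _<ℝ_ _≤ℝ_

_<ℝ_ : ℝ → ℝ → Set
x <ℝ y = ∃ λ δ → 0ℚ ℚ.< δ ×
  ∃ λ N → ∀ n → N ℕ.≤ n → seq x n ℚ.+ δ ℚ.≤ seq y n

_≤ℝ_ : ℝ → ℝ → Set
x ≤ℝ y = ∀ δ → 0ℚ ℚ.< δ →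
  ∃ λ N → ∀ n → N ℕ.≤ n → seq x n ℚ.≤ seq y n ℚ.+ δ

fromℚ : ℚ → ℝ
fromℚ q = mkℝ (λ _ → q) λ δ 0<δ → 0 , λ _ _ _ _ →
  subst (ℚ._≤ δ) (sym (cong ∣_∣ (ℚₚ.+-inverseʳ q))) (ℚₚ.<⇒≤ 0<δ)

fromℕ : ℕ → ℝ
fromℕ n = fromℚ (+ n ℚ./ 1)

private
  open ℚₚ.≤-Reasoning
  open CommutativeSemigroupProperties
    (CommutativeMonoid.commutativeSemigroup ℚₚ.+-0-commutativeMonoid)
    using (interchange)

  telescope : ∀ p q r → (p ℚ.- q) ℚ.+ (q ℚ.- r) ≡ p ℚ.- r
  telescope p q r = begin-equality
    (p ℚ.- q) ℚ.+ (q ℚ.- r)         ≡⟨ ℚₚ.+-assoc p (ℚ.- q) (q ℚ.- r) ⟩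
    p ℚ.+ (ℚ.- q ℚ.+ (q ℚ.- r))     ≡⟨ cong (p ℚ.+_) (ℚₚ.+-assoc (ℚ.- q) q (ℚ.- r)) ⟨
    p ℚ.+ ((ℚ.- q ℚ.+ q) ℚ.- r)     ≡⟨ cong (λ z → p ℚ.+ (z ℚ.- r)) (ℚₚ.+-inverseˡ q) ⟩
    p ℚ.+ (0ℚ ℚ.- r)                ≡⟨ cong (p ℚ.+_) (ℚₚ.+-identityˡ (ℚ.- r)) ⟩
    p ℚ.- r ∎

  module _ (s t : ℕ → ℚ) where

    cauchy-+ : Cauchy s → Cauchy t → Cauchy (λ n → s n ℚ.+ t n)
    cauchy-+ cs ct δ 0<δ = N , bound
      where
      0<δ/2 : 0ℚ ℚ.< δ ℚ.* ½
      0<δ/2 = ℚₚ.positive⁻¹ (δ ℚ.* ½) {{ℚₚ.pos*pos⇒pos δ {{ℚ.positive 0<δ}} ½}}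
      S = cs (δ ℚ.* ½) 0<δ/2
      T = ct (δ ℚ.* ½) 0<δ/2
      N = proj₁ S ℕ.⊔ proj₁ T
      regroup : ∀ a b c d →
        (a ℚ.+ b) ℚ.- (c ℚ.+ d) ≡ (a ℚ.- c) ℚ.+ (b ℚ.- d)
      regroup a b c d = trans
        (cong ((a ℚ.+ b) ℚ.+_) (ℚₚ.neg-distrib-+ c d))
        (interchange a b (ℚ.- c) (ℚ.- d))
      bound : ∀ m n → N ℕ.≤ m → N ℕ.≤ n →
        ∣ (s m ℚ.+ t m) ℚ.- (s n ℚ.+ t n) ∣ ℚ.≤ δ
      bound m n N≤m N≤n = begin
        ∣ (s m ℚ.+ t m) ℚ.- (s n ℚ.+ t n) ∣
          ≡⟨ cong ∣_∣ (regroup (s m) (t m) (s n) (t n)) ⟩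
        ∣ (s m ℚ.- s n) ℚ.+ (t m ℚ.- t n) ∣
          ≤⟨ ℚₚ.∣p+q∣≤∣p∣+∣q∣ (s m ℚ.- s n) (t m ℚ.- t n) ⟩
        ∣ s m ℚ.- s n ∣ ℚ.+ ∣ t m ℚ.- t n ∣
          ≤⟨ ℚₚ.+-mono-≤
               (proj₂ S m n (ℕₚ.m⊔n≤o⇒m≤o _ _ N≤m) (ℕₚ.m⊔n≤o⇒m≤o _ _ N≤n))
               (proj₂ T m n (ℕₚ.m⊔n≤o⇒n≤o _ _ N≤m) (ℕₚ.m⊔n≤o⇒n≤o _ _ N≤n)) ⟩
        δ ℚ.* ½ ℚ.+ δ ℚ.* ½
          ≡⟨ sym (ℚₚ.*-distribˡ-+ δ ½ ½) ⟩
        δ ℚ.* 1ℚ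
          ≡⟨ ℚₚ.*-identityʳ δ ⟩
        δ ∎

  cauchy-neg : ∀ s → Cauchy s → Cauchy (ℚ.-_ ∘ s)
  cauchy-neg s cs δ 0<δ = proj₁ (cs δ 0<δ) , λ m n N≤m N≤n →
    subst (ℚ._≤ δ)
      (trans (sym (ℚₚ.∣-p∣≡∣p∣ (s m ℚ.- s n)))
             (cong ∣_∣ (ℚₚ.neg-distrib-+ (s m) (ℚ.- s n))))
      (proj₂ (cs δ 0<δ) m n N≤m N≤n)

  bounded : ∀ s → Cauchy s →
    Σ ℚ λ K → Positive K × ∃ λ N → ∀ n → N ℕ.≤ n → ∣ s n ∣ ℚ.≤ K
  bounded s cs = K , ℚ.positive 0<K , N , bound
    where
    S = cs 1ℚ (ℚₚ.positive⁻¹ 1ℚ)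
    N = proj₁ S
    K = 1ℚ ℚ.+ ∣ s N ∣
    0<K : 0ℚ ℚ.< K
    0<K = ℚₚ.+-mono-<-≤ (ℚₚ.positive⁻¹ 1ℚ) (ℚₚ.0≤∣p∣ (s N))
    split : ∀ a b → a ≡ (a ℚ.- b) ℚ.+ b
    split a b = sym (trans (ℚₚ.+-assoc a (ℚ.- b) b)
      (trans (cong (a ℚ.+_) (ℚₚ.+-inverseˡ b)) (ℚₚ.+-identityʳ a)))
    bound : ∀ n → N ℕ.≤ n → ∣ s n ∣ ℚ.≤ K
    bound n N≤n = begin
      ∣ s n ∣                         ≡⟨ cong ∣_∣ (split (s n) (s N)) ⟩
      ∣ (s n ℚ.- s N) ℚ.+ s N ∣       ≤⟨ ℚₚ.∣p+q∣≤∣p∣+∣q∣ (s n ℚ.- s N) (s N) ⟩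
      ∣ s n ℚ.- s N ∣ ℚ.+ ∣ s N ∣     ≤⟨ ℚₚ.+-monoˡ-≤ ∣ s N ∣ (proj₂ S n N N≤n ℕₚ.≤-refl) ⟩
      K ∎

  ∣*∣-mono-≤ : ∀ p q {k l} → ∣ p ∣ ℚ.≤ k → ∣ q ∣ ℚ.≤ l → ∣ p ℚ.* q ∣ ℚ.≤ k ℚ.* l
  ∣*∣-mono-≤ p q {k} {l} p≤k q≤l = begin
    ∣ p ℚ.* q ∣       ≡⟨ ℚₚ.∣p*q∣≡∣p∣*∣q∣ p q ⟩
    ∣ p ∣ ℚ.* ∣ q ∣   ≤⟨ ℚₚ.*-monoʳ-≤-nonNeg ∣ q ∣ {{ℚ.nonNegative (ℚₚ.0≤∣p∣ q)}} p≤k ⟩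
    k ℚ.* ∣ q ∣       ≤⟨ ℚₚ.*-monoˡ-≤-nonNeg k
                           {{ℚ.nonNegative (ℚₚ.≤-trans (ℚₚ.0≤∣p∣ p) p≤k)}} q≤l ⟩
    k ℚ.* l ∎

  module _ (s t : ℕ → ℚ) where

    cauchy-* : Cauchy s → Cauchy t → Cauchy (λ n → s n ℚ.* t n)
    cauchy-* cs ct δ 0<δ with bounded s cs | bounded t ct
    ... | K , K>0 , Nₖ , s≤K | L , L>0 , Nₗ , t≤L = N , bound
      where
      instance
        K+L-pos : Positive (K ℚ.+ L)
        K+L-pos = ℚ.positive (ℚₚ.+-mono-<
          (ℚₚ.positive⁻¹ K {{K>0}}) (ℚₚ.positive⁻¹ L {{L>0}}))
        K+L-nonZero : ℚ.NonZero (K ℚ.+ L)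
        K+L-nonZero = ℚₚ.pos⇒nonZero (K ℚ.+ L)
      η = δ ℚ.* (1/ (K ℚ.+ L))
      0<η : 0ℚ ℚ.< η
      0<η = ℚₚ.positive⁻¹ η
        {{ℚₚ.pos*pos⇒pos δ {{ℚ.positive 0<δ}} (1/ (K ℚ.+ L)) {{ℚₚ.1/pos⇒pos (K ℚ.+ L)}}}}
      S = cs η 0<η
      T = ct η 0<η
      N = (Nₖ ℕ.⊔ Nₗ) ℕ.⊔ (proj₁ S ℕ.⊔ proj₁ T)
      regroup : ∀ a b c d →
        (a ℚ.* b) ℚ.- (c ℚ.* d) ≡ a ℚ.* (b ℚ.- d) ℚ.+ (a ℚ.- c) ℚ.* d
      regroup a b c d = sym (begin-equality
        a ℚ.* (b ℚ.- d) ℚ.+ (a ℚ.- c) ℚ.* d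
          ≡⟨ cong₂ ℚ._+_ (ℚₚ.*-distribˡ-+ a b (ℚ.- d)) (ℚₚ.*-distribʳ-+ d a (ℚ.- c)) ⟩
        (a ℚ.* b ℚ.+ a ℚ.* ℚ.- d) ℚ.+ (a ℚ.* d ℚ.+ ℚ.- c ℚ.* d)
          ≡⟨ cong₂ (λ p q → (a ℚ.* b ℚ.+ p) ℚ.+ (a ℚ.* d ℚ.+ q))
               (ℚₚ.neg-distribʳ-* a d) (ℚₚ.neg-distribˡ-* c d) ⟨
        (a ℚ.* b ℚ.- a ℚ.* d) ℚ.+ (a ℚ.* d ℚ.- c ℚ.* d)
          ≡⟨ telescope (a ℚ.* b) (a ℚ.* d) (c ℚ.* d) ⟩
        a ℚ.* b ℚ.- c ℚ.* d ∎)
      factor : ∀ k l e → k ℚ.* e ℚ.+ e ℚ.* l ≡ e ℚ.* (k ℚ.+ l)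
      factor k l e = trans
        (cong (ℚ._+ e ℚ.* l) (ℚₚ.*-comm k e)) (sym (ℚₚ.*-distribˡ-+ e k l))
      bound : ∀ m n → N ℕ.≤ m → N ℕ.≤ n →
        ∣ (s m ℚ.* t m) ℚ.- (s n ℚ.* t n) ∣ ℚ.≤ δ
      bound m n N≤m N≤n = begin
        ∣ (s m ℚ.* t m) ℚ.- (s n ℚ.* t n) ∣
          ≡⟨ cong ∣_∣ (regroup (s m) (t m) (s n) (t n)) ⟩
        ∣ s m ℚ.* (t m ℚ.- t n) ℚ.+ (s m ℚ.- s n) ℚ.* t n ∣
          ≤⟨ ℚₚ.∣p+q∣≤∣p∣+∣q∣ (s m ℚ.* (t m ℚ.- t n)) ((s m ℚ.- s n) ℚ.* t n) ⟩
        ∣ s m ℚ.* (t m ℚ.- t n) ∣ ℚ.+ ∣ (s m ℚ.- s n) ℚ.* t n ∣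
          ≤⟨ ℚₚ.+-mono-≤
               (∣*∣-mono-≤ (s m) (t m ℚ.- t n)
                 (s≤K m (ℕₚ.m⊔n≤o⇒m≤o _ _ (KL N≤m)))
                 (proj₂ T m n (ℕₚ.m⊔n≤o⇒n≤o _ _ (ST N≤m)) (ℕₚ.m⊔n≤o⇒n≤o _ _ (ST N≤n))))
               (∣*∣-mono-≤ (s m ℚ.- s n) (t n)
                 (proj₂ S m n (ℕₚ.m⊔n≤o⇒m≤o _ _ (ST N≤m)) (ℕₚ.m⊔n≤o⇒m≤o _ _ (ST N≤n)))
                 (t≤L n (ℕₚ.m⊔n≤o⇒n≤o _ _ (KL N≤n)))) ⟩
        K ℚ.* η ℚ.+ η ℚ.* L
          ≡⟨ factor K L η ⟩
        δ ℚ.* (1/ (K ℚ.+ L)) ℚ.* (K ℚ.+ L)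
          ≡⟨ ℚₚ.*-assoc δ (1/ (K ℚ.+ L)) (K ℚ.+ L) ⟩
        δ ℚ.* (1/ (K ℚ.+ L) ℚ.* (K ℚ.+ L))
          ≡⟨ cong (δ ℚ.*_) (ℚₚ.*-inverseˡ (K ℚ.+ L)) ⟩
        δ ℚ.* 1ℚ
          ≡⟨ ℚₚ.*-identityʳ δ ⟩
        δ ∎
        where
        KL : ∀ {o} → N ℕ.≤ o → Nₖ ℕ.⊔ Nₗ ℕ.≤ o
        KL = ℕₚ.m⊔n≤o⇒m≤o (Nₖ ℕ.⊔ Nₗ) _
        ST : ∀ {o} → N ℕ.≤ o → proj₁ S ℕ.⊔ proj₁ T ℕ.≤ o
        ST = ℕₚ.m⊔n≤o⇒n≤o (Nₖ ℕ.⊔ Nₗ) _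

infixl 7 _*ℝ_
infixl 6 _-ℝ_

_-ℝ_ : ℝ → ℝ → ℝ
x -ℝ y = mkℝ (λ n → seq x n ℚ.- seq y n)
  (cauchy-+ (seq x) (λ n → ℚ.- seq y n) (cauchy x) (cauchy-neg (seq y) (cauchy y)))

_*ℝ_ : ℝ → ℝ → ℝ
x *ℝ y = mkℝ (λ n → seq x n ℚ.* seq y n)
  (cauchy-* (seq x) (seq y) (cauchy x) (cauchy y))

-- The vertex classes are A = Fin m and B = Fin n; a graph is its edge relation.
BipartiteGraph : ℕ → ℕ → Set₁
BipartiteGraph m n = REL (Fin m) (Fin n) 0ℓ

-- Finite edge sets are lists.  In a matching the listed edges are pairwise
-- disjoint, hence distinct, so its cardinality is the length of the list.
EdgeSet : ℕ → ℕ → Set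
EdgeSet m n = List (Fin m × Fin n)

module _ {m n : ℕ} where

  VertexDisjoint : (e f : Fin m × Fin n) → Set
  VertexDisjoint (a , b) (a′ , b′) = a ≢ a′ × b ≢ b′

  IsMatching : BipartiteGraph m n → EdgeSet m n → Set
  IsMatching G M = All (uncurry G) M × AllPairs VertexDisjoint M

  IsMaximal : BipartiteGraph m n → EdgeSet m n → Set
  IsMaximal G M = IsMatching G M × (∀ e → ¬ IsMatching G (e ∷ M))

  IsMaximum : BipartiteGraph m n → EdgeSet m n → Set
  IsMaximum G M =
    IsMatching G M × (∀ M′ → IsMatching G M′ → length M′ ℕ.≤ length M)

  A⟨_⟩ : EdgeSet m n → List (Fin m)
  A⟨ N ⟩ = map proj₁ N

  B⟨_⟩ : EdgeSet m n → List (Fin n)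
  B⟨ N ⟩ = map proj₂ N

data Version : Set where
  withoutFreezing : Version
  withFreezing    : (ε : ℝ) → Version

-- For ε > 0 the condition k ≤ 3/ε is k·ε ≤ 3.
NotFrozen : Version → ℕ → Set
NotFrozen withoutFreezing  k = ⊤
NotFrozen (withFreezing ε) k = fromℕ k *ℝ ε ≤ℝ fromℕ 3

record State (m n : ℕ) : Set where
  constructor ⟨_,_⟩
  field
    M : EdgeSet m n
    c : Fin n → ℕ

module ALT {m n : ℕ} (G : BipartiteGraph m n) (v : Version) where

  open State

  -- k = min { c(b) : b ∈ Γ(a) }; no such k exists if a is isolated.
  IsCMin : (Fin n → ℕ) → Fin m → ℕ → Set
  IsCMin c a k = (∃ λ b → G a b × c b ≡ k) × (∀ b → G a b → k ℕ.≤ c b)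

  H : State m n → BipartiteGraph m n
  H s a b = G a b × a ∉ A⟨ M s ⟩ × IsCMin (c s) a (c s b) × NotFrozen v (c s b)

  init : State m n
  init = ⟨ [] , (λ _ → 0) ⟩

  step : State m n → EdgeSet m n → State m n
  step s N =
    ⟨ filter (λ e → ¬? (proj₂ e ∈? B⟨ N ⟩)) (M s) ++ N
    , (λ b → if does (b ∈? B⟨ N ⟩) then suc (c s b) else c s b)
    ⟩
    where open DecMembership (_≟_ {n}) using (_∈?_)

  -- State after r rounds, where N r is the matching chosen in round r ≥ 1
  -- (N 0 is not used).
  after : (ℕ → EdgeSet m n) → ℕ → State m n
  after N zero    = init
  after N (suc r) = step (after N r) (N (suc r))

  IsExecution : (ℕ → EdgeSet m n) → Set
  IsExecution N = ∀ r → IsMaximal (H (after N r)) (N (suc r))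

  matchingAfter : (ℕ → EdgeSet m n) → ℕ → EdgeSet m n
  matchingAfter N r = M (after N r)

-- Both classes have indices 0, …, 3x-2.  For the last a-vertex the second
-- alternative is void, since there is no b-vertex of index 3x-1.
path : (x : ℕ) → BipartiteGraph (3 ℕ.* x ∸ 1) (3 ℕ.* x ∸ 1)
path x a b = toℕ b ≡ toℕ a ⊎ toℕ b ≡ suc (toℕ a)

-- Some execution on G holds, after every number r of rounds with r ≤ C/ε²,
-- only matchings M with |M| < (1-ε)|OPT|.  For ε > 0, r ≤ C/ε² is r·ε² ≤ C.
SlowExecution : ∀ {m n} → BipartiteGraph m n → Version → (C ε : ℝ) → Set
SlowExecution {m} {n} G v C ε =
  ∃ λ (N : ℕ → EdgeSet m n) → IsExecution N ×
  (∀ r → fromℕ r *ℝ (ε *ℝ ε) ≤ℝ C →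
   ∀ OPT → IsMaximum G OPT →
   fromℕ (length (matchingAfter N r)) <ℝ (fromℕ 1 -ℝ ε) *ℝ fromℕ (length OPT))
  where open ALT G v

{-# OPTIONS --safe #-}
{-
Write n = 3x - 1.  In three rounds the algorithm can reach a matching whose only
free a-vertex is the last but one of the path and whose only free b-vertex is
b_0, with counters 0 1 2 | 1 1 2 | 1 1 2 | ... | 1 2.  From then on a round moves
the free a-vertex one step past the b-vertex of smaller counter and increases
that counter; break ties by moving right.

A move left past b_i happens only if c(b_i) < c(b_{i+1}), so c is nondecreasing
to the right of the free vertex.  The parity of c(b_i) depends only on the initial
counter and on the side of b_i on which the free vertex is, so two of every three
of these inequalities are strict.  When b_0 is finally reached, c(b_{3m}) is
therefore at least 2m for all m.  The sum of the counters is then quadratic in x,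
and each of these rounds adds 1 to it.

To the left of the free vertex c(b_i) is at most i, so the vertices chosen always
have counters below n.  For x of order 1/ε with nε ≤ 3/4 none of them is frozen,
and a deficiency of 1 keeps |M| below (1-ε)n.
-}
module Submission where

open import Defs
open import Algebra.Bundles using (CommutativeMonoid)
import Algebra.Properties.CommutativeSemigroup as CommutativeSemigroupProperties
open import Data.Bool using (Bool; true; false; not; _∨_; if_then_else_; T)
open import Data.Bool.Properties using (∨-identityʳ; ∨-zeroʳ; not-injective; not-involutive)
open import Data.Empty using (⊥; ⊥-elim)
open import Data.Fin using (Fin; toℕ; fromℕ<)
open import Data.Fin.Properties using (toℕ-injective; toℕ<n; toℕ-fromℕ<; injective⇒≤)
  renaming (_≟_ to _≟F_)
open import Data.Integer as ℤ using (+_; +[1+_])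
import Data.Integer.Properties as ℤₚ
open import Data.List
  using (List; []; _∷_; _++_; map; filter; length; lookup; allFin; cartesianProduct)
open import Data.List.Properties using (length-map; length-tabulate)
open import Data.List.Membership.Propositional using (_∈_; _∉_)
open import Data.List.Membership.Propositional.Properties
  using (∈-filter⁺; ∈-filter⁻; ∈-++⁺ˡ; ∈-++⁺ʳ; ∈-++⁻; ∈-map⁺; ∈-map⁻;
         ∈-cartesianProduct⁺; ∈-allFin; ∈-lookup)
import Data.List.Membership.DecPropositional as DecMembership
open import Data.List.Relation.Unary.All as All using (All; []; _∷_)
import Data.List.Relation.Unary.All.Properties as Allₚ
open import Data.List.Relation.Unary.Any using (here; there)
open import Data.List.Relation.Unary.AllPairs as AllPairs using (AllPairs; []; _∷_)
import Data.List.Relation.Unary.AllPairs.Properties as AllPairsₚ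
open import Data.List.Relation.Unary.Unique.Propositional using (Unique)
import Data.List.Relation.Unary.Unique.Propositional.Properties as Uniqueₚ
open import Data.Nat
open import Data.Nat.DivMod using (m/n*n≤m; m%n<n; m≡m%n+[m/n]*n)
open import Data.Nat.Properties
open import Data.Nat.Tactic.RingSolver using (solve-∀)
open import Data.Product using (∃; _×_; _,_; proj₁; proj₂)
open import Data.Rational as ℚ using (ℚ; mkℚ; 0ℚ; ½; Positive; toℚᵘ)
import Data.Rational.Properties as ℚₚ
open import Data.Rational.Unnormalised as ℚᵘ using (mkℚᵘ; _≃_; *≡*; *≤*)
import Data.Rational.Unnormalised.Properties as ℚᵘₚ
open import Data.Sum using (_⊎_; inj₁; inj₂; [_,_]′)
open import Data.Unit using (⊤; tt)
open import Function using (_∘_)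
open import Relation.Binary.Definitions using (tri<; tri≈; tri>)
open import Relation.Binary.PropositionalEquality hiding ([_])
open import Relation.Nullary using (¬_; ¬?; yes; no; Dec; contradiction)
open import Relation.Nullary.Decidable using (_×-dec_; toWitness)

-- Duplicate-free lists and the sizes of matchings.

Unique⇒lookup-injective : ∀ {A : Set} {xs : List A} → Unique xs →
  ∀ {i j} → lookup xs i ≡ lookup xs j → i ≡ j
Unique⇒lookup-injective (_ ∷ _) {Fin.zero} {Fin.zero} _ = refl
Unique⇒lookup-injective {xs = _ ∷ xs} (x∉ ∷ _) {Fin.zero} {Fin.suc j} eq =
  contradiction eq (All.lookup x∉ (∈-lookup {xs = xs} j))
Unique⇒lookup-injective {xs = _ ∷ xs} (x∉ ∷ _) {Fin.suc i} {Fin.zero} eq =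
  contradiction (sym eq) (All.lookup x∉ (∈-lookup {xs = xs} i))
Unique⇒lookup-injective (_ ∷ u) {Fin.suc i} {Fin.suc j} eq =
  cong Fin.suc (Unique⇒lookup-injective u eq)

Unique⇒length≤ : ∀ {n} {xs : List (Fin n)} → Unique xs → length xs ≤ n
Unique⇒length≤ u = injective⇒≤ (Unique⇒lookup-injective u)

AllPairs-tabulate : ∀ {A : Set} {R : A → A → Set} {xs} → Unique xs →
  (∀ {x y} → x ∈ xs → y ∈ xs → x ≢ y → R x y) → AllPairs R xs
AllPairs-tabulate [] r = []
AllPairs-tabulate {xs = x ∷ xs} (x∉ ∷ u) r =
  All.tabulate (λ y∈ → r (here refl) (there y∈) (All.lookup x∉ y∈)) ∷
  AllPairs-tabulate u (λ x∈ y∈ → r (there x∈) (there y∈))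

module _ {m n : ℕ} where

  disjoint⇒Unique-A : {M : EdgeSet m n} → AllPairs VertexDisjoint M → Unique A⟨ M ⟩
  disjoint⇒Unique-A = AllPairsₚ.map⁺ ∘ AllPairs.map proj₁

  matching-length≤ : {M : EdgeSet m n} → AllPairs VertexDisjoint M → length M ≤ m
  matching-length≤ {M} dis =
    subst (_≤ m) (length-map proj₁ M) (Unique⇒length≤ (disjoint⇒Unique-A dis))

  -- Adding the free vertex to `A⟨ M ⟩` keeps the list duplicate-free, so at most m - 1 vertices are
  -- matched.
  matching-length< : {M : EdgeSet m n} {a : Fin m} →
    AllPairs VertexDisjoint M → a ∉ A⟨ M ⟩ → length M < m
  matching-length< {M} {a} dis a∉ =
    subst (_< m) (length-map proj₁ M) (Unique⇒length≤
      (All.tabulate (λ y∈ a≡y → a∉ (subst (_∈ A⟨ M ⟩) (sym a≡y) y∈)) ∷ disjoint⇒Unique-A dis))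

-- Disjointness under `step` and a criterion for maximality.

module _ {m n : ℕ} (G : BipartiteGraph m n) (v : Version) where
  open ALT G v
  open State

  -- Surviving old edges avoid B(N) by the filter, and new edges start outside A(M) by the
  -- definition of `H`, so an old and a new edge share no end.
  step-disjoint : ∀ s N → AllPairs VertexDisjoint (M s) → IsMatching (H s) N →
    AllPairs VertexDisjoint (M (step s N))
  step-disjoint s N dis (inH , disN) = AllPairsₚ.++⁺
    (AllPairsₚ.filter⁺ _ dis) disN
    (All.tabulate λ e∈ → All.tabulate λ f∈ →
      let e∈M , e∉N = ∈-filter⁻ (λ e → ¬? (proj₂ e ∈? B⟨ N ⟩)) {xs = M s} e∈
          _ , free , _ = All.lookup inH f∈
      in (λ eq → free (subst (_∈ A⟨ M s ⟩) eq (∈-map⁺ proj₁ e∈M)))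
       , (λ eq → e∉N (subst (_∈ B⟨ N ⟩) (sym eq) (∈-map⁺ proj₂ f∈))))
    where open DecMembership (_≟F_ {n}) using (_∈?_)

  after-disjoint : ∀ N r → (∀ q → q < r → IsMatching (H (after N q)) (N (suc q))) →
    AllPairs VertexDisjoint (matchingAfter N r)
  after-disjoint N zero    _  = []
  after-disjoint N (suc r) ok = step-disjoint (after N r) (N (suc r))
    (after-disjoint N r (λ q q<r → ok q (m<n⇒m<1+n q<r))) (ok r ≤-refl)

  covering⇒maximal : ∀ s N → IsMatching (H s) N →
    (∀ a b → H s a b → a ∈ A⟨ N ⟩ ⊎ b ∈ B⟨ N ⟩) → IsMaximal (H s) N
  covering⇒maximal s N ok cover = ok , notAddable
    where
    notAddable : ∀ e → ¬ IsMatching (H s) (e ∷ N)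
    notAddable (a , b) (h ∷ _ , dis ∷ _) with cover a b h
    ... | inj₁ a∈ with ∈-map⁻ proj₁ a∈
    ...   | e , e∈ , eq = proj₁ (All.lookup dis e∈) eq
    notAddable (a , b) (h ∷ _ , dis ∷ _) | inj₂ b∈ with ∈-map⁻ proj₂ b∈
    ...   | e , e∈ , eq = proj₂ (All.lookup dis e∈) eq

-- Matchings and rounds on the path, encoded by statuses.

-- In the path, b_a is the left and b_{a+1} the right neighbour of a.  A status
-- records the partner of an a-vertex, or the choice it makes in a round.
data Status : Set where
  free left right : Status

target : Status → ℕ → ℕ
-- Default value: for a free vertex, `keep` yields `free` for either answer of `taken`.
target free  a = a
target left  a = a
target right a = suc a

Holds : Status → ℕ → ℕ → Set
Holds free  a b = ⊥
Holds left  a b = b ≡ a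
Holds right a b = b ≡ suc a

holds? : ∀ s a b → Dec (Holds s a b)
holds? free  a b = no λ ()
holds? left  a b = b ≟ a
holds? right a b = b ≟ suc a

Holds⇒target : ∀ s {a b} → Holds s a b → b ≡ target s a
Holds⇒target left  eq = eq
Holds⇒target right eq = eq

Holds⇒≢free : ∀ s {a b} → Holds s a b → s ≢ free
Holds⇒≢free left  _ ()
Holds⇒≢free right _ ()

isLeft isRight : Status → Bool
isLeft left = true
isLeft _    = false
isRight right = true
isRight _     = false

-- Boolean-valued, so that the explicit rounds of the opening can be evaluated.
taken : (ℕ → Status) → ℕ → Bool
taken g zero    = isLeft (g zero)
taken g (suc b) = isLeft (g (suc b)) ∨ isRight (g b)

keep : Bool → Status → Status
keep true  s = free
keep false s = s

override : Status → Bool → Status → Status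
override free  t s = keep t s
override left  _ _ = left
override right _ _ = right

-- Step (iv) of the algorithm seen from an a-vertex: its own choice wins, and otherwise it keeps its
-- partner unless that partner is taken.
newStatus : (ℕ → Status) → (ℕ → Status) → ℕ → Status
newStatus g f a = override (g a) (taken g (target (f a) a)) (f a)

newLevel : (ℕ → Status) → (ℕ → ℕ) → ℕ → ℕ
newLevel g lv b = if taken g b then suc (lv b) else lv b

isLeft⁻ : ∀ s → isLeft s ≡ true → s ≡ left
isLeft⁻ left _ = refl

isRight⁻ : ∀ s → isRight s ≡ true → s ≡ right
isRight⁻ right _ = refl

left-taken : ∀ g a → g a ≡ left → taken g a ≡ true
left-taken g zero    eq rewrite eq = refl
left-taken g (suc a) eq rewrite eq = refl

right-taken : ∀ g a → g a ≡ right → taken g (suc a) ≡ true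
right-taken g a eq rewrite eq = ∨-zeroʳ _

taken⁻ : ∀ g b → taken g b ≡ true → g b ≡ left ⊎ ∃ λ a → b ≡ suc a × g a ≡ right
taken⁻ g zero    t = inj₁ (isLeft⁻ _ t)
taken⁻ g (suc b) t with isLeft (g (suc b)) in eq
... | true  = inj₁ (isLeft⁻ _ eq)
... | false = inj₂ (b , refl , isRight⁻ _ t)

-- Translation between statuses and states of the algorithm.

module Line (n : ℕ) where

  -- The relation of `path` with the class size as a variable: `3 * suc y ∸ 1` equals `2 + y * 3`
  -- only up to a proof, and the second form is the one used for period 3.
  line : BipartiteGraph n n
  line a b = toℕ b ≡ toℕ a ⊎ toℕ b ≡ suc (toℕ a)

  chosen? : (g : ℕ → Status) (e : Fin n × Fin n) →
    Dec (Holds (g (toℕ (proj₁ e))) (toℕ (proj₁ e)) (toℕ (proj₂ e)))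
  chosen? g (a , b) = holds? (g (toℕ a)) (toℕ a) (toℕ b)

  edges : (ℕ → Status) → EdgeSet n n
  edges g = filter (chosen? g) (cartesianProduct (allFin n) (allFin n))

  ∈-edges⁺ : ∀ g {a b : Fin n} → Holds (g (toℕ a)) (toℕ a) (toℕ b) → (a , b) ∈ edges g
  ∈-edges⁺ g h = ∈-filter⁺ (chosen? g) (∈-cartesianProduct⁺ (∈-allFin _) (∈-allFin _)) h

  ∈-edges⁻ : ∀ g {a b : Fin n} → (a , b) ∈ edges g → Holds (g (toℕ a)) (toℕ a) (toℕ b)
  ∈-edges⁻ g e∈ = proj₂ (∈-filter⁻ (chosen? g) {xs = cartesianProduct (allFin n) (allFin n)} e∈)

  edges-unique : ∀ g → Unique (edges g)
  edges-unique g = Uniqueₚ.filter⁺ (chosen? g) (Uniqueₚ.cartesianProduct⁺ (Uniqueₚ.allFin⁺ n) (Uniqueₚ.allFin⁺ n))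

  -- The last a-vertex has no right neighbour, so status `right` there would describe no edge.
  InRange : (ℕ → Status) → Set
  InRange g = ∀ {a} → a < n → g a ≡ right → suc a < n

  hold : ∀ {g} → InRange g → (a : Fin n) → g (toℕ a) ≢ free →
    ∃ λ (b : Fin n) → Holds (g (toℕ a)) (toℕ a) (toℕ b)
  hold {g} inr a ≢free with g (toℕ a) in eq
  ... | free  = contradiction refl ≢free
  ... | left  = a , refl
  ... | right = fromℕ< (inr (toℕ<n a) eq) , toℕ-fromℕ< _

  ∈B⇒taken : ∀ g {b : Fin n} → b ∈ B⟨ edges g ⟩ → taken g (toℕ b) ≡ true
  ∈B⇒taken g b∈ with ∈-map⁻ proj₂ b∈
  ... | (a , b) , e∈ , refl with g (toℕ a) in eq | ∈-edges⁻ g e∈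
  ... | left  | b≡a  rewrite b≡a = left-taken g _ eq
  ... | right | b≡1+a rewrite b≡1+a = right-taken g _ eq

  taken⇒∈B : ∀ g {b : Fin n} → taken g (toℕ b) ≡ true → b ∈ B⟨ edges g ⟩
  taken⇒∈B g {b} t with taken⁻ g (toℕ b) t
  ... | inj₁ gb≡left = ∈-map⁺ proj₂ (∈-edges⁺ g {b} {b} (subst (λ s → Holds s (toℕ b) (toℕ b)) (sym gb≡left) refl))
  ... | inj₂ (a , b≡1+a , ga≡right) = ∈-map⁺ proj₂ (∈-edges⁺ g {fromℕ< a<n} {b}
      (subst (λ i → Holds (g i) i (toℕ b)) (sym (toℕ-fromℕ< a<n))
        (subst (λ s → Holds s a (toℕ b)) (sym ga≡right) b≡1+a)))
    where
    a<n : a < n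
    a<n = <-trans (subst (a <_) (sym b≡1+a) (n<1+n a)) (toℕ<n b)

  -- Best lv σ a says that the neighbour of a selected by σ has level c_min(a).
  Best : (ℕ → ℕ) → Status → ℕ → Set
  Best lv free  a = ⊤
  Best lv left  a = suc a < n → lv a ≤ lv (suc a)
  Best lv right a = suc a < n × lv (suc a) ≤ lv a

  -- Legality of a round in terms of functions on ℕ, without edge lists. `low` is what rules out
  -- freezing, and `no-clash` excludes the only way in which two a-vertices can compete for one
  -- b-vertex.
  record Valid (f : ℕ → Status) (lv : ℕ → ℕ) (g : ℕ → Status) : Set where
    field
      from-free : ∀ {a} → a < n → g a ≢ free → f a ≡ free
      best      : ∀ {a} → a < n → Best lv (g a) a
      low       : ∀ {a} → a < n → f a ≡ free → lv a < n
      no-clash  : ∀ {a} → suc a < n → g a ≡ right → g (suc a) ≢ left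
      maximal   : ∀ {a} → a < n → f a ≡ free → g a ≡ free → ∀ s → s ≢ free →
                  Best lv s a → taken g (target s a) ≡ true

    inRange : InRange g
    inRange {a} a<n eq with g a | best a<n
    inRange a<n refl | right | (1+a<n , _) = 1+a<n

  functional : ∀ s {a} {b b′ : Fin n} →
    Holds s a (toℕ b) → Holds s a (toℕ b′) → b ≡ b′
  functional s h h′ = toℕ-injective (trans (Holds⇒target s h) (sym (Holds⇒target s h′)))

  module _ (v : Version) (notFrozen : ∀ k → k < n → NotFrozen v k) where
    open ALT line v
    open State

    -- Membership is compared instead of lists, because `step` lists edges in another order than
    -- `edges`.
    record Snapshot (s : State n n) (f : ℕ → Status) (lv : ℕ → ℕ) : Set where
      field
        ∈⇒holds : ∀ {a b} → (a , b) ∈ M s → Holds (f (toℕ a)) (toℕ a) (toℕ b)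
        holds⇒∈ : ∀ {a b} → Holds (f (toℕ a)) (toℕ a) (toℕ b) → (a , b) ∈ M s
        level   : ∀ b → c s b ≡ lv (toℕ b)
        inRange : InRange f

      free⇒∉ : ∀ {a} → f (toℕ a) ≡ free → a ∉ A⟨ M s ⟩
      free⇒∉ eq a∈ with ∈-map⁻ proj₁ a∈
      ... | (a , b) , e∈ , refl = subst (λ s → Holds s (toℕ a) (toℕ b)) eq (∈⇒holds e∈)

      ∉⇒free : ∀ {a} → a ∉ A⟨ M s ⟩ → f (toℕ a) ≡ free
      ∉⇒free {a} a∉ with f (toℕ a) in eq
      ... | free = refl
      ... | left = contradiction (∈-map⁺ proj₁ (holds⇒∈ {a} {a}
              (subst (λ s → Holds s (toℕ a) (toℕ a)) (sym eq) refl))) a∉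
      ... | right with hold {f} inRange a (λ eq′ → case (trans (sym eq) eq′))
        where case : right ≢ free
              case ()
      ...   | b , h = contradiction (∈-map⁺ proj₁ (holds⇒∈ h)) a∉

    module _ {s : State n n} {f : ℕ → Status} {lv : ℕ → ℕ} (snap : Snapshot s f lv)
             {g : ℕ → Status} (valid : Valid f lv g) where
      open Snapshot snap
      open Valid valid hiding (inRange)

      edges-path : ∀ {a b} → (a , b) ∈ edges g → line a b
      edges-path {a} e∈ with g (toℕ a) | ∈-edges⁻ g e∈
      ... | left  | eq = inj₁ eq
      ... | right | eq = inj₂ eq

      -- An a-vertex has at most two neighbours, so a single comparison decides the minimum.
      best⇒cmin : ∀ σ {a b} → Best lv σ (toℕ a) → Holds σ (toℕ a) (toℕ b) →
        ∀ b′ → line a b′ → c s b ≤ c s b′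
      best⇒cmin σ {a} {b} bst h b′ l rewrite level b | level b′ with σ | bst | h | l
      ... | left | le | b≡ | inj₁ b′≡ rewrite b≡ | b′≡ = ≤-refl
      ... | left | le | b≡ | inj₂ b′≡ rewrite b≡ =
        subst (λ i → lv (toℕ a) ≤ lv i) (sym b′≡) (le (subst (_< n) b′≡ (toℕ<n b′)))
      ... | right | _ , le | b≡ | inj₁ b′≡ rewrite b≡ | b′≡ = le
      ... | right | _ , le | b≡ | inj₂ b′≡ rewrite b≡ | b′≡ = ≤-refl

      -- Going right is chosen only for a counter no larger than the left one, so the bound on the
      -- left counter suffices.
      chosen-low : ∀ σ {a b} → lv a < n → Best lv σ a → Holds σ a b → lv b < n
      chosen-low left  l bst refl = l
      chosen-low right l (_ , le) refl = ≤-<-trans le l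

      edges-in-H : ∀ {a b} → (a , b) ∈ edges g → H s a b
      edges-in-H {a} {b} e∈ =
        edges-path e∈ , free⇒∉ fa ,
        ((b , edges-path e∈ , refl) , best⇒cmin (g (toℕ a)) (best (toℕ<n a)) h) ,
        notFrozen _ (subst (_< n) (sym (level b))
          (chosen-low (g (toℕ a)) (low (toℕ<n a) fa) (best (toℕ<n a)) h))
        where
        h = ∈-edges⁻ g e∈
        fa = from-free (toℕ<n a) (Holds⇒≢free _ h)

      -- Two choices of the same side have different ends; choices of opposite sides can meet only
      -- between neighbours, which `no-clash` forbids.
      clash : ∀ {a a′ b : Fin n} → Holds (g (toℕ a)) (toℕ a) (toℕ b) →
        Holds (g (toℕ a′)) (toℕ a′) (toℕ b) → a ≡ a′
      clash {a} {a′} {b} h h′ with g (toℕ a) in ga | g (toℕ a′) in ga′ | h | h′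
      ... | left  | left  | b≡ | b≡′ = toℕ-injective (trans (sym b≡) b≡′)
      ... | right | right | b≡ | b≡′ = toℕ-injective (suc-injective (trans (sym b≡) b≡′))
      ... | left  | right | b≡ | b≡′ = contradiction
        (subst (λ i → g i ≡ left) (trans (sym b≡) b≡′) ga)
        (no-clash (subst (_< n) b≡′ (toℕ<n b)) ga′)
      ... | right | left  | b≡ | b≡′ = contradiction
        (subst (λ i → g i ≡ left) (trans (sym b≡′) b≡) ga′)
        (no-clash (subst (_< n) b≡ (toℕ<n b)) ga)

      edges-disjoint : AllPairs VertexDisjoint (edges g)
      edges-disjoint = AllPairs-tabulate (edges-unique g) λ {(a , b)} {(a′ , b′)} e∈ e′∈ e≢ →
        (λ where refl → e≢ (cong (a ,_) (functional (g (toℕ a)) (∈-edges⁻ g e∈) (∈-edges⁻ g e′∈))))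
        , (λ where refl → e≢ (cong (_, b) (clash (∈-edges⁻ g e∈) (∈-edges⁻ g e′∈))))

      edges-matching : IsMatching (H s) (edges g)
      edges-matching = All.tabulate edges-in-H , edges-disjoint

      -- Makes `maximal` applicable to any edge of `H` at an idle vertex, showing that its b-vertex
      -- is already taken.
      H⇒best : ∀ {a b} → H s a b →
        ∃ λ σ → σ ≢ free × Best lv σ (toℕ a) × toℕ b ≡ target σ (toℕ a)
      H⇒best {a} {b} (inj₁ b≡ , _ , (_ , min) , _) = left , (λ ()) , le , b≡
        where
        le : suc (toℕ a) < n → lv (toℕ a) ≤ lv (suc (toℕ a))
        le 1+a<n with min (fromℕ< 1+a<n) (inj₂ (toℕ-fromℕ< 1+a<n))
        ... | cb≤ rewrite level b | level (fromℕ< 1+a<n) | b≡ | toℕ-fromℕ< 1+a<n = cb≤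
      H⇒best {a} {b} (inj₂ b≡ , _ , (_ , min) , _) =
        right , (λ ()) , (subst (_< n) b≡ (toℕ<n b) , le) , b≡
        where
        le : lv (suc (toℕ a)) ≤ lv (toℕ a)
        le with min a (inj₁ refl)
        ... | cb≤ rewrite level b | level a | b≡ = cb≤

      edges-maximal : IsMaximal (H s) (edges g)
      edges-maximal = covering⇒maximal line v s (edges g) edges-matching cover
        where
        cover : ∀ a b → H s a b → a ∈ A⟨ edges g ⟩ ⊎ b ∈ B⟨ edges g ⟩
        cover a b h@(_ , a∉ , _) with g (toℕ a) in ga
        ... | free with H⇒best h
        ...   | σ , σ≢ , bst , b≡ = inj₂ (taken⇒∈B g (subst (λ i → taken g i ≡ true) (sym b≡)
                 (maximal (toℕ<n a) (∉⇒free a∉) ga σ σ≢ bst)))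
        cover a b h | left  = inj₁ (∈-map⁺ proj₁ (∈-edges⁺ g {a} {a}
                 (subst (λ s → Holds s (toℕ a) (toℕ a)) (sym ga) refl)))
        cover a b h | right with hold {g} (Valid.inRange valid) a (λ eq → right≢free (trans (sym ga) eq))
          where right≢free : right ≢ free
                right≢free ()
        ...   | b′ , h′ = inj₁ (∈-map⁺ proj₁ (∈-edges⁺ g h′))

      module _ {f′ : ℕ → Status} {lv′ : ℕ → ℕ}
               (f′≗ : ∀ {a} → a < n → f′ a ≡ newStatus g f a)
               (lv′≗ : ∀ {b} → b < n → lv′ b ≡ newLevel g lv b) where

        open DecMembership (_≟F_ {n}) using (_∈?_)

        private
          N = edges g
          kept? = λ (e : Fin n × Fin n) → ¬? (proj₂ e ∈? B⟨ N ⟩)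

        new-∈⇒holds : ∀ {a b} → (a , b) ∈ M (step s N) →
          Holds (newStatus g f (toℕ a)) (toℕ a) (toℕ b)
        new-∈⇒holds {a} {b} e∈ with ∈-++⁻ (filter kept? (M s)) e∈
        ... | inj₁ old with ∈-filter⁻ kept? {xs = M s} old
        ...   | e∈M , b∉ with g (toℕ a) in ga
        -- A vertex that chooses in this round was free before, so it has no edge in M.
        ...     | left  = contradiction
                    (from-free (toℕ<n a) (λ eq → Holds⇒≢free left {0} refl (trans (sym ga) eq)))
                    (Holds⇒≢free _ (∈⇒holds e∈M))
        ...     | right = contradiction
                    (from-free (toℕ<n a) (λ eq → Holds⇒≢free right {0} refl (trans (sym ga) eq)))
                    (Holds⇒≢free _ (∈⇒holds e∈M))
        ...     | free with taken g (target (f (toℕ a)) (toℕ a)) in t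
        ...       | false = ∈⇒holds e∈M
        -- The partner is taken, so the filter in `step` has removed this edge.
        ...       | true  = contradiction (taken⇒∈B g (subst (λ i → taken g i ≡ true)
                      (sym (Holds⇒target (f (toℕ a)) (∈⇒holds e∈M))) t)) b∉
        new-∈⇒holds {a} {b} e∈ | inj₂ new with g (toℕ a) | ∈-edges⁻ g new
        ... | left  | h = h
        ... | right | h = h

        new-holds⇒∈ : ∀ {a b} → Holds (newStatus g f (toℕ a)) (toℕ a) (toℕ b) →
          (a , b) ∈ M (step s N)
        new-holds⇒∈ {a} {b} h with g (toℕ a) in ga
        ... | left  = ∈-++⁺ʳ (filter kept? (M s)) (∈-edges⁺ g
                        (subst (λ s → Holds s (toℕ a) (toℕ b)) (sym ga) h))
        ... | right = ∈-++⁺ʳ (filter kept? (M s)) (∈-edges⁺ g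
                        (subst (λ s → Holds s (toℕ a) (toℕ b)) (sym ga) h))
        ... | free with taken g (target (f (toℕ a)) (toℕ a)) in t
        ...   | false = ∈-++⁺ˡ (∈-filter⁺ kept? (holds⇒∈ h) λ b∈ →
                  case (trans (sym t) (subst (λ i → taken g i ≡ true)
                    (Holds⇒target (f (toℕ a)) h) (∈B⇒taken g b∈))))
          where case : false ≢ true
                case ()

        new-level : ∀ b → c (step s N) b ≡ newLevel g lv (toℕ b)
        new-level b with b ∈? B⟨ N ⟩ | taken g (toℕ b) in t
        ... | yes b∈ | true  = cong suc (level b)
        ... | no  b∉ | false = level b
        ... | yes b∈ | false = contradiction (trans (sym t) (∈B⇒taken g b∈)) (λ ())
        ... | no  b∉ | true  = contradiction (taken⇒∈B g t) b∉

        new-inRange : InRange (newStatus g f)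
        new-inRange {a} a<n eq with g a in ga
        ... | right = Valid.inRange valid a<n ga
        ... | free with taken g (target (f a) a)
        ...   | false = inRange a<n eq

        step-snapshot : Snapshot (step s N) f′ lv′
        step-snapshot = record
          { ∈⇒holds = λ {a} {b} e∈ → subst (λ σ → Holds σ (toℕ a) (toℕ b))
              (sym (f′≗ (toℕ<n a))) (new-∈⇒holds e∈)
          ; holds⇒∈ = λ {a} {b} h → new-holds⇒∈ (subst (λ σ → Holds σ (toℕ a) (toℕ b))
              (f′≗ (toℕ<n a)) h)
          ; level = λ b → trans (new-level b) (sym (lv′≗ (toℕ<n b)))
          ; inRange = λ a<n eq → new-inRange a<n (trans (sym (f′≗ a<n)) eq)
          }

-- Executions generated by a schedule of statuses.

-- The recurrences hold pointwise and below n, so that closed forms may replace iterated `newStatus`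
-- and `newLevel`.
record Schedule (n : ℕ) : Set where
  open Line n
  field
    f     : ℕ → ℕ → Status
    lv    : ℕ → ℕ → ℕ
    g     : ℕ → ℕ → Status
    f₀    : ∀ a → f 0 a ≡ free
    lv₀   : ∀ b → lv 0 b ≡ 0
    valid : ∀ r → Valid (f r) (lv r) (g r)
    fₛ    : ∀ r {a} → a < n → f (suc r) a ≡ newStatus (g r) (f r) a
    lvₛ   : ∀ r {b} → b < n → lv (suc r) b ≡ newLevel (g r) (lv r) b

module _ {n : ℕ} (S : Schedule n) (v : Version) (notFrozen : ∀ k → k < n → NotFrozen v k) where
  open Schedule S
  open Line n
  open ALT line v

  scheduled : ℕ → EdgeSet n n
  scheduled zero    = []
  scheduled (suc r) = edges (g r)

  scheduled-snapshot : ∀ r → Snapshot v notFrozen (after scheduled r) (f r) (lv r)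
  scheduled-snapshot zero = record
    { ∈⇒holds = λ ()
    ; holds⇒∈ = λ {a} {b} h → ⊥-elim (subst (λ σ → Holds σ (toℕ a) (toℕ b)) (f₀ (toℕ a)) h)
    ; level = λ b → sym (lv₀ (toℕ b))
    ; inRange = λ {a} _ eq → contradiction (trans (sym (f₀ a)) eq) (λ ()) }
  scheduled-snapshot (suc r) =
    step-snapshot v notFrozen (scheduled-snapshot r) (valid r) (fₛ r) (lvₛ r)

  scheduled-execution : IsExecution scheduled
  scheduled-execution r = edges-maximal v notFrozen (scheduled-snapshot r) (valid r)

  scheduled-deficient : ∀ r {a} → a < n → f r a ≡ free → length (matchingAfter scheduled r) < n
  scheduled-deficient r {a} a<n fa = matching-length<
    (after-disjoint line v scheduled r (λ q _ → proj₁ (scheduled-execution q)))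
    (Snapshot.free⇒∉ (scheduled-snapshot r) {fromℕ< a<n} (trans (cong (f r) (toℕ-fromℕ< a<n)) fa))

-- Matchings with a single free a-vertex, and its moves.

-- A position p > 0 stands for the single free a-vertex p - 1, and p = 0 for
-- the perfect matching.
tokenStatus : ℕ → ℕ → Status
tokenStatus zero          a       = left
tokenStatus (suc zero)    zero    = free
tokenStatus (suc zero)    (suc a) = left
tokenStatus (suc (suc p)) zero    = right
tokenStatus (suc (suc p)) (suc a) = tokenStatus (suc p) a

tokenMove : ℕ → Status → ℕ → Status
tokenMove zero          d a       = free
tokenMove (suc zero)    d zero    = d
tokenMove (suc zero)    d (suc a) = free
tokenMove (suc (suc p)) d zero    = free
tokenMove (suc (suc p)) d (suc a) = tokenMove (suc p) d a

bump : ℕ → (ℕ → ℕ) → ℕ → ℕ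
bump k lv b = if b ≡ᵇ k then suc (lv b) else lv b

tokenStatus-free : ∀ a → tokenStatus (suc a) a ≡ free
tokenStatus-free zero    = refl
tokenStatus-free (suc a) = tokenStatus-free a

tokenStatus-free⁻ : ∀ p a → tokenStatus p a ≡ free → p ≡ suc a
tokenStatus-free⁻ (suc zero)    zero    _  = refl
tokenStatus-free⁻ (suc (suc p)) (suc a) eq = cong suc (tokenStatus-free⁻ (suc p) a eq)

tokenStatus-right : ∀ {p a} → suc a < p → tokenStatus p a ≡ right
tokenStatus-right {suc (suc p)} {zero}  _        = refl
tokenStatus-right {suc (suc p)} {suc a} (s≤s lt) = tokenStatus-right {suc p} lt
tokenStatus-right {suc zero}            (s≤s ())

tokenStatus-left : ∀ {p a} → p ≤ a → tokenStatus p a ≡ left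
tokenStatus-left {zero}                  _        = refl
tokenStatus-left {suc zero}    {suc a} _        = refl
tokenStatus-left {suc (suc p)} {suc a} (s≤s le) = tokenStatus-left {suc p} le

tokenMove-at : ∀ a d → tokenMove (suc a) d a ≡ d
tokenMove-at zero    d = refl
tokenMove-at (suc a) d = tokenMove-at a d

tokenMove-≢free⁻ : ∀ p d a → tokenMove p d a ≢ free → p ≡ suc a
tokenMove-≢free⁻ zero          d a       ≢free = contradiction refl ≢free
tokenMove-≢free⁻ (suc zero)    d zero    ≢free = refl
tokenMove-≢free⁻ (suc zero)    d (suc a) ≢free = contradiction refl ≢free
tokenMove-≢free⁻ (suc (suc p)) d zero    ≢free = contradiction refl ≢free
tokenMove-≢free⁻ (suc (suc p)) d (suc a) ≢free = cong suc (tokenMove-≢free⁻ (suc p) d a ≢free)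

taken-left : ∀ t b → taken (tokenMove (suc t) left) b ≡ (b ≡ᵇ t)
taken-left zero    zero          = refl
taken-left zero    (suc zero)    = refl
taken-left zero    (suc (suc b)) = refl
taken-left (suc t) zero          = refl
taken-left (suc t) (suc zero)    = trans (∨-identityʳ _) (taken-left t zero)
taken-left (suc t) (suc (suc b)) = taken-left t (suc b)

taken-right : ∀ t b → taken (tokenMove (suc t) right) b ≡ (b ≡ᵇ suc t)
taken-right zero    zero          = refl
taken-right zero    (suc zero)    = refl
taken-right zero    (suc (suc b)) = refl
taken-right (suc t) zero          = refl
taken-right (suc t) (suc zero)    = trans (∨-identityʳ _) (taken-right t zero)
taken-right (suc t) (suc (suc b)) = taken-right t (suc b)

target-suc : ∀ σ a → target σ (suc a) ≡ suc (target σ a)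
target-suc free  a = refl
target-suc left  a = refl
target-suc right a = refl

-- The move takes b_t from a_(t-1), which becomes the free vertex; for t = 0 nobody holds b_0 and
-- the matching becomes perfect.
newStatus-left : ∀ t a → newStatus (tokenMove (suc t) left) (tokenStatus (suc t)) a ≡ tokenStatus t a
newStatus-left t a = trans (cong (λ b → override (tokenMove (suc t) left a) b (tokenStatus (suc t) a))
  (taken-left t (target (tokenStatus (suc t) a) a))) (lemma t a)
  where
  -- With `taken` replaced by a comparison, the claim is stable under shifting t and a together, so
  -- induction applies.
  lemma : ∀ t a → override (tokenMove (suc t) left a) (target (tokenStatus (suc t) a) a ≡ᵇ t)
    (tokenStatus (suc t) a) ≡ tokenStatus t a
  lemma zero          zero    = refl
  lemma zero          (suc a) = refl
  lemma (suc zero)    zero    = refl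
  lemma (suc (suc t)) zero    = refl
  lemma (suc zero)    (suc a) rewrite target-suc (tokenStatus 1 a) a = lemma zero a
  lemma (suc (suc t)) (suc a) rewrite target-suc (tokenStatus (2 + t) a) a = lemma (suc t) a

-- Here b_(t+1) is taken from a_(t+1), which becomes free.
newStatus-right : ∀ t a → newStatus (tokenMove (suc t) right) (tokenStatus (suc t)) a ≡ tokenStatus (2 + t) a
newStatus-right t a = trans (cong (λ b → override (tokenMove (suc t) right a) b (tokenStatus (suc t) a))
  (taken-right t (target (tokenStatus (suc t) a) a))) (lemma t a)
  where
  lemma : ∀ t a → override (tokenMove (suc t) right a) (target (tokenStatus (suc t) a) a ≡ᵇ suc t)
    (tokenStatus (suc t) a) ≡ tokenStatus (2 + t) a
  lemma zero    zero          = refl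
  lemma zero    (suc zero)    = refl
  lemma zero    (suc (suc a)) = refl
  lemma (suc t) zero          = refl
  lemma (suc t) (suc a) rewrite target-suc (tokenStatus (suc t) a) a = lemma t a

-- Single increments and sums of counters.

≡ᵇ-refl : ∀ k → (k ≡ᵇ k) ≡ true
≡ᵇ-refl zero    = refl
≡ᵇ-refl (suc k) = ≡ᵇ-refl k

≢⇒≡ᵇ : ∀ {i k} → i ≢ k → (i ≡ᵇ k) ≡ false
≢⇒≡ᵇ {i} {k} i≢k with i ≡ᵇ k in eq
... | false = refl
... | true  = contradiction (≡ᵇ⇒≡ i k (subst T (sym eq) tt)) i≢k

bump-same : ∀ k lv → bump k lv k ≡ suc (lv k)
bump-same k lv rewrite ≡ᵇ-refl k = refl

bump-other : ∀ {i k} lv → i ≢ k → bump k lv i ≡ lv i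
bump-other lv i≢k rewrite ≢⇒≡ᵇ i≢k = refl

sumTo : ℕ → (ℕ → ℕ) → ℕ
sumTo zero    lv = 0
sumTo (suc k) lv = lv k + sumTo k lv

sumTo-cong : ∀ k {f g : ℕ → ℕ} → (∀ {i} → i < k → f i ≡ g i) → sumTo k f ≡ sumTo k g
sumTo-cong zero    eq = refl
sumTo-cong (suc k) eq = cong₂ _+_ (eq ≤-refl) (sumTo-cong k (eq ∘ m<n⇒m<1+n))

-- Only an inequality, since an increment at an index j ≥ k leaves the sum unchanged.
sumTo-bump : ∀ k j lv → sumTo k (bump j lv) ≤ suc (sumTo k lv)
sumTo-bump zero    j lv = z≤n
sumTo-bump (suc k) j lv with k ≟ j
... | yes refl rewrite bump-same k lv | sumTo-cong k (λ {i} i<k → bump-other {i} lv (<⇒≢ i<k)) = ≤-refl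
... | no k≢j rewrite bump-other lv k≢j =
  ≤-trans (+-monoʳ-≤ (lv k) (sumTo-bump k j lv)) (≤-reflexive (+-suc (lv k) _))

sumTo-bounded : ∀ k {lv h} → (∀ i → lv i ≤ h) → sumTo k lv ≤ k * h
sumTo-bounded zero    le = z≤n
sumTo-bounded (suc k) le = +-mono-≤ (le k) (sumTo-bounded k le)

-- Parities and residues modulo 3.

isOdd : ℕ → Bool
isOdd zero    = false
isOdd (suc k) = not (isOdd k)

-- Three constructors instead of numbers, so that a case split evaluates the tables of period 3.
data Residue : Set where
  r0 r1 r2 : Residue

next : Residue → Residue
next r0 = r1
next r1 = r2
next r2 = r0

residue : ℕ → Residue
residue zero    = r0
residue (suc a) = next (residue a)

residue-3* : ∀ m → residue (m * 3) ≡ r0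
residue-3* zero = refl
residue-3* (suc m) rewrite residue-3* m = refl

-- The parity of c(b_i) for 0 < i while the free a-vertex is to the right of
-- b_i; it flips each time that vertex passes b_i.
oddBefore : Residue → Bool
oddBefore r0 = true
oddBefore r1 = true
oddBefore r2 = false

-- The walk of the free vertex and its length.

module Rotor (n : ℕ) where
  open Line n

  record Config : Set where
    constructor _at_
    field
      levels : ℕ → ℕ
      position : ℕ

  -- A negative answer means that a_t is the last vertex or that its left counter is strictly
  -- smaller; this strictness keeps the counters sorted to the right of the walker.
  goesRight? : ∀ t (lv : ℕ → ℕ) → Dec (suc t < n × lv (suc t) ≤ lv t)
  goesRight? t lv = (suc t <? n) ×-dec (lv (suc t) ≤? lv t)

  direction : ℕ → (ℕ → ℕ) → Status
  direction t lv with goesRight? t lv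
  ... | yes _ = right
  ... | no  _ = left

  -- At position 0 the matching is perfect and `H` has no edge, so the execution goes on with empty
  -- rounds.
  move : Config → ℕ → Status
  move (lv at zero)  = λ _ → free
  move (lv at suc t) = tokenMove (suc t) (direction t lv)

  advance : Config → Config
  advance (lv at zero) = lv at zero
  advance (lv at suc t) with goesRight? t lv
  ... | yes _ = bump (suc t) lv at (2 + t)
  ... | no  _ = bump t lv at t

  iterate : ℕ → Config → Config
  iterate zero    s = s
  iterate (suc r) s = advance (iterate r s)

  advance-status : ∀ s a → tokenStatus (Config.position (advance s)) a
    ≡ newStatus (move s) (tokenStatus (Config.position s)) a
  advance-status (lv at zero) zero = refl
  advance-status (lv at zero) (suc a) = refl
  advance-status (lv at suc t) a with goesRight? t lv
  ... | yes _ = sym (newStatus-right t a)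
  ... | no  _ = sym (newStatus-left t a)

  advance-levels : ∀ s b → Config.levels (advance s) b ≡ newLevel (move s) (Config.levels s) b
  advance-levels (lv at zero) zero = refl
  advance-levels (lv at zero) (suc b) = refl
  advance-levels (lv at suc t) b with goesRight? t lv
  ... | yes _ rewrite taken-right t b = refl
  ... | no  _ rewrite taken-left t b = refl

  -- For the free vertex a_t the position is t + 1, so b_t counts as lying to its left and b_(t+1)
  -- to its right. The parities omit b_0, whose counter starts at 0 although `oddBefore` gives odd
  -- for its residue.
  record Invariant (s : Config) : Set where
    open Config s
    field
      inside      : position ≤ n
      low         : ∀ {i} → i < position → levels i ≤ i
      monotone    : ∀ {i} → position ≤ i → suc i < n → levels i ≤ levels (suc i)
      parityLeft  : ∀ {i} → 0 < i → i < position → isOdd (levels i) ≡ oddBefore (residue i)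
      parityRight : ∀ {i} → 0 < i → position ≤ i → i < n →
                    isOdd (levels i) ≡ not (oddBefore (residue i))

  move-valid : ∀ {s} → Invariant s → Valid (tokenStatus (Config.position s)) (Config.levels s) (move s)
  move-valid {lv at zero} inv = record
    { from-free = λ _ ≢free → contradiction refl ≢free
    ; best = λ _ → tt ; low = λ _ () ; no-clash = λ _ () ; maximal = λ _ () }
  move-valid {lv at suc t} inv = record
    { from-free = λ {a} _ ≢free → let t≡a = suc-injective (tokenMove-≢free⁻ (suc t) d a ≢free) in
        subst (λ t → tokenStatus (suc t) a ≡ free) (sym t≡a) (tokenStatus-free a)
    ; best = best
    ; low = λ {a} a<n fa → let t≡a = suc-injective (tokenStatus-free⁻ (suc t) a fa) in
        ≤-<-trans (Invariant.low inv (≤-reflexive (cong suc (sym t≡a)))) a<n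
    ; no-clash = λ {a} _ ga ga′ →
        1+n≢n (trans (sym (tokenMove-≢free⁻ (suc t) d (suc a) (λ eq → left≢free (trans (sym ga′) eq))))
              (tokenMove-≢free⁻ (suc t) d a (λ eq → right≢free (trans (sym ga) eq))))
    -- The only free vertex always moves, so no free vertex is idle.
    ; maximal = λ {a} _ fa ga → contradiction
        (trans (sym (tokenMove-at a d)) (subst (λ t → tokenMove (suc t) d a ≡ free)
          (suc-injective (tokenStatus-free⁻ (suc t) a fa)) ga)) d≢free
    }
    where
    d = direction t lv
    left≢free : left ≢ free
    left≢free ()
    right≢free : right ≢ free
    right≢free ()
    d≢free : d ≢ free
    d≢free with goesRight? t lv
    ... | yes _ = right≢free
    ... | no  _ = left≢free
    d-best : Best lv d t
    d-best with goesRight? t lv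
    ... | yes ok  = ok
    ... | no  ¬ok = λ 1+t<n → <⇒≤ (≰⇒> λ le → ¬ok (1+t<n , le))
    best : ∀ {a} → a < n → Best lv (tokenMove (suc t) d a) a
    best {a} _ with a ≟ t
    ... | yes refl = subst (λ σ → Best lv σ t) (sym (tokenMove-at t d)) d-best
    ... | no a≢t with tokenMove (suc t) d a in eq
    ...   | free  = tt
    ...   | left  = contradiction
      (sym (suc-injective (tokenMove-≢free⁻ (suc t) d a (λ eq′ → left≢free (trans (sym eq) eq′))))) a≢t
    ...   | right = contradiction
      (sym (suc-injective (tokenMove-≢free⁻ (suc t) d a (λ eq′ → right≢free (trans (sym eq) eq′))))) a≢t

  -- Only the passed b-vertex changes sides, and its increment flips its parity accordingly. After a
  -- right move its counter is at most lv t + 1, hence at most t + 1. Before a left move lv t < lv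
  -- (t+1) unless a_t is last, so `monotone` extends by one index.
  advance-invariant : ∀ {s} → Invariant s → Invariant (advance s)
  advance-invariant {lv at zero} inv = inv
  advance-invariant {lv at suc t} inv with goesRight? t lv
  ... | yes (1+t<n , le) = record
    { inside = 1+t<n
    ; low = low′
    ; monotone = λ {i} 2+t≤i 1+i<n → subst₂ _≤_
        (sym (bump-other lv (>⇒≢ 2+t≤i))) (sym (bump-other lv (>⇒≢ (m≤n⇒m≤1+n 2+t≤i))))
        (monotone (<⇒≤ 2+t≤i) 1+i<n)
    ; parityLeft = parityLeft′
    ; parityRight = λ {i} 0<i 2+t≤i i<n → trans (cong isOdd (bump-other lv (>⇒≢ 2+t≤i)))
        (parityRight 0<i (<⇒≤ 2+t≤i) i<n)
    }
    where
    open Invariant inv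
    low′ : ∀ {i} → i < 2 + t → bump (suc t) lv i ≤ i
    low′ {i} (s≤s i≤1+t) with i ≟ suc t
    ... | yes refl rewrite bump-same (suc t) lv = s≤s (≤-trans le (low ≤-refl))
    ... | no i≢ rewrite bump-other lv i≢ = low (≤∧≢⇒< i≤1+t i≢)
    parityLeft′ : ∀ {i} → 0 < i → i < 2 + t → isOdd (bump (suc t) lv i) ≡ oddBefore (residue i)
    parityLeft′ {i} 0<i (s≤s i≤1+t) with i ≟ suc t
    ... | yes refl
      rewrite bump-same (suc t) lv | parityRight 0<i ≤-refl 1+t<n =
      not-involutive (oddBefore (residue (suc t)))
    ... | no i≢ rewrite bump-other lv i≢ = parityLeft 0<i (≤∧≢⇒< i≤1+t i≢)
  ... | no ¬ok = record
    { inside = <⇒≤ inside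
    ; low = λ {i} i<t → subst (_≤ i) (sym (bump-other lv (<⇒≢ i<t))) (low (m<n⇒m<1+n i<t))
    ; monotone = monotone′
    ; parityLeft = λ {i} 0<i i<t → trans (cong isOdd (bump-other lv (<⇒≢ i<t)))
        (parityLeft 0<i (m<n⇒m<1+n i<t))
    ; parityRight = parityRight′
    }
    where
    open Invariant inv
    monotone′ : ∀ {i} → t ≤ i → suc i < n → bump t lv i ≤ bump t lv (suc i)
    monotone′ {i} t≤i 1+i<n rewrite bump-other lv (>⇒≢ (s≤s t≤i)) with i ≟ t
    ... | yes refl rewrite bump-same t lv = ≰⇒> λ le → ¬ok (1+i<n , le)
    ... | no i≢t rewrite bump-other lv i≢t = monotone (≤∧≢⇒< t≤i (i≢t ∘ sym)) 1+i<n
    parityRight′ : ∀ {i} → 0 < i → t ≤ i → i < n → isOdd (bump t lv i) ≡ not (oddBefore (residue i))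
    parityRight′ {i} 0<i t≤i i<n with i ≟ t
    ... | yes refl rewrite bump-same t lv | parityLeft 0<i ≤-refl = refl
    ... | no i≢t rewrite bump-other lv i≢t = parityRight 0<i (≤∧≢⇒< t≤i (i≢t ∘ sym)) i<n

  iterate-invariant : ∀ r {s} → Invariant s → Invariant (iterate r s)
  iterate-invariant zero    inv = inv
  iterate-invariant (suc r) inv = advance-invariant (iterate-invariant r inv)

  sumTo-advance : ∀ k s → sumTo k (Config.levels (advance s)) ≤ suc (sumTo k (Config.levels s))
  sumTo-advance k (lv at zero) = n≤1+n _
  sumTo-advance k (lv at suc t) with goesRight? t lv
  ... | yes _ = sumTo-bump k (suc t) lv
  ... | no  _ = sumTo-bump k t lv

  sumTo-iterate : ∀ k r s → sumTo k (Config.levels (iterate r s)) ≤ r + sumTo k (Config.levels s)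
  sumTo-iterate k zero    s = ≤-refl
  sumTo-iterate k (suc r) s = ≤-trans (sumTo-advance k (iterate r s)) (s≤s (sumTo-iterate k r s))

  module _ {lv : ℕ → ℕ} (inv : Invariant (lv at 0)) where
    open Invariant inv

    -- Equal counters would have equal parities. The indices start at 1, where the parity invariant
    -- begins.
    ascent : ∀ {i} → suc (suc i) < n → oddBefore (residue (suc i)) ≢ oddBefore (residue (suc (suc i))) →
      lv (suc i) < lv (suc (suc i))
    ascent {i} 2+i<n differ = ≤∧≢⇒< (monotone z≤n 2+i<n) λ eq → differ (not-injective
      (trans (sym (parityRight (s≤s z≤n) z≤n (<⇒≤ 2+i<n)))
        (trans (cong isOdd eq) (parityRight (s≤s z≤n) z≤n 2+i<n))))

    -- Along the residues 0, 1, 2, 0 the parities are equal, then differ twice: one weak step and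
    -- two strict ones.
    blockAscent : ∀ m → 3 + m * 3 < n → 2 + lv (m * 3) ≤ lv (3 + m * 3)
    blockAscent m lt = ≤-trans (s≤s (≤-trans (s≤s (monotone z≤n (≤-trans (m≤n+m _ 2) lt)))
      (ascent (<⇒≤ lt) differ₁))) (ascent lt differ₂)
      where
      differ₁ : oddBefore (residue (1 + m * 3)) ≢ oddBefore (residue (2 + m * 3))
      differ₁ rewrite residue-3* m = λ ()
      differ₂ : oddBefore (residue (2 + m * 3)) ≢ oddBefore (residue (3 + m * 3))
      differ₂ rewrite residue-3* m = λ ()

    linear : ∀ m → m * 3 < n → 2 * m ≤ lv (m * 3)
    linear zero    _  = z≤n
    linear (suc m) lt = ≤-trans (≤-reflexive (*-suc 2 m))
      (≤-trans (s≤s (s≤s (linear m (≤-trans (m≤n+m _ 3) lt)))) (blockAscent m lt))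

    -- The three counters of block j are at least 2j each, and summing 6j over j < m gives 3m² - 3m;
    -- the subtracted term stands on the other side.
    quadratic : ∀ m → m * 3 < n → 3 * (m * m) ≤ 3 * m + sumTo (m * 3) lv
    quadratic zero    _  = z≤n
    quadratic (suc m) lt = begin
      3 * (suc m * suc m)                            ≡⟨ expand m ⟩
      3 + (2 * m + (2 * m + (2 * m + 3 * (m * m))))
        ≤⟨ +-monoʳ-≤ 3 (+-mono-≤ at2 (+-mono-≤ at1 (+-mono-≤ at0 (quadratic m (≤-trans (m≤n+m _ 3) lt))))) ⟩
      3 + (l2 + (l1 + (l0 + (3 * m + S))))           ≡⟨ collect m l2 l1 l0 S ⟩
      3 * suc m + (l2 + (l1 + (l0 + S))) ∎
      where
      open ≤-Reasoning
      l0 = lv (m * 3)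
      l1 = lv (1 + m * 3)
      l2 = lv (2 + m * 3)
      S = sumTo (m * 3) lv
      at0 : 2 * m ≤ l0
      at0 = linear m (≤-trans (m≤n+m _ 3) lt)
      at1 : 2 * m ≤ l1
      at1 = ≤-trans at0 (monotone z≤n (≤-trans (m≤n+m _ 2) lt))
      at2 : 2 * m ≤ l2
      at2 = ≤-trans at1 (monotone z≤n (<⇒≤ lt))
      expand : ∀ m → 3 * (suc m * suc m) ≡ 3 + (2 * m + (2 * m + (2 * m + 3 * (m * m))))
      expand = solve-∀
      collect : ∀ m a b c s → 3 + (a + (b + (c + (3 * m + s)))) ≡ 3 * suc m + (a + (b + (c + s)))
      collect = solve-∀

  -- The initial counters sum to at most 9y, so arrival at b_0 within r rounds gives 3y² ≤ r + 12y.
  -- With r < y² this fails once 12y ≤ 2y², which is where 6 ≤ y comes from.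
  slow : ∀ y → 6 ≤ y → y * 3 < n → ∀ {s} → (∀ i → Config.levels s i ≤ 3) → Invariant s →
    ∀ r → r < y * y → Config.position (iterate r s) ≢ 0
  slow y 6≤y y3<n {s} le3 inv r r<y² p≡0 with iterate r s | iterate-invariant r inv | sumTo-iterate (y * 3) r s
  slow y 6≤y y3<n {s} le3 inv r r<y² refl | lv at .0 | inv′ | sum≤ = <-irrefl refl (begin-strict
    3 * (y * y)                               ≤⟨ quadratic inv′ y y3<n ⟩
    3 * y + sumTo (y * 3) lv                  ≤⟨ +-monoʳ-≤ (3 * y) sum≤ ⟩
    3 * y + (r + sumTo (y * 3) (Config.levels s)) ≤⟨ +-monoʳ-≤ (3 * y) (+-monoʳ-≤ r (sumTo-bounded (y * 3) le3)) ⟩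
    3 * y + (r + y * 3 * 3)                   ≡⟨ collect y r ⟩
    r + 2 * (6 * y)                           <⟨ +-monoˡ-< (2 * (6 * y)) r<y² ⟩
    y * y + 2 * (6 * y)                       ≤⟨ +-monoʳ-≤ (y * y) (*-monoʳ-≤ 2 (*-monoˡ-≤ y 6≤y)) ⟩
    y * y + 2 * (y * y)                       ≡⟨⟩
    3 * (y * y) ∎)
    where
    open ≤-Reasoning
    collect : ∀ y r → 3 * y + (r + y * 3 * 3) ≡ r + 2 * (6 * y)
    collect = solve-∀

-- The three opening rounds and the complete schedule.

newLevel-≤ : ∀ g lv b → newLevel g lv b ≤ suc (lv b)
newLevel-≤ g lv b with taken g b
... | true  = ≤-refl
... | false = n≤1+n _

keep-free : ∀ b → keep b free ≡ free
keep-free true  = refl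
keep-free false = refl

module Opening (y : ℕ) (1≤y : 1 ≤ y) where

  k n : ℕ
  k = y * 3
  n = 2 + k

  open Line n
  open Rotor n

  -- a_(3j) and a_(3j+2) take the two neighbours of a_(3j+1), which stays free. The counters become
  -- 0 1 1 | 0 1 1 | ... | 0 1.
  by₁ : Residue → Status
  by₁ r0 = right
  by₁ r1 = free
  by₁ r2 = left

  -- The flag marks the last vertex, which must go left and displaces a_k; every other a_(3j+1)
  -- displaces a_(3j+2). The counters become 0 1 2 | 0 1 2 | ... | 0 2.
  by₂ : Residue → Bool → Status
  by₂ r1 true  = left
  by₂ r1 false = right
  by₂ _  _     = free

  by₃ : Residue → Status
  by₃ r2 = right
  by₃ _  = free

  move₁ move₂ move₃ : ℕ → Status
  move₁ a = by₁ (residue a)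
  move₂ a = by₂ (residue a) (a ≡ᵇ suc k)
  move₃ a = by₃ (residue a)

  -- All vertices are free at first, so the statuses after round one are `move₁` itself.
  status₂ : ℕ → Status
  status₂ = newStatus move₂ move₁

  level₁ level₂ level₃ : ℕ → ℕ
  level₁ = newLevel move₁ (λ _ → 0)
  level₂ = newLevel move₂ level₁
  level₃ = newLevel move₃ level₂

  start : Config
  start = level₃ at suc k

  residue-k : residue k ≡ r0
  residue-k = residue-3* y

  residue-last : residue (suc k) ≡ r1
  residue-last rewrite residue-k = refl

  not-last : ∀ {a} → a < n → residue a ≢ r1 → suc a < n
  not-last {a} (s≤s a≤1+k) ≢r1 = s≤s (≤∧≢⇒< a≤1+k λ where refl → ≢r1 residue-last)

  before-last : ∀ {a} → suc a < n → (a ≡ᵇ suc k) ≡ false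
  before-last (s≤s lt) = ≢⇒≡ᵇ (<⇒≢ lt)

  level₁-≤ : ∀ b → level₁ b ≤ 1
  level₁-≤ b = newLevel-≤ move₁ (λ _ → 0) b

  level₂-≤ : ∀ b → level₂ b ≤ 2
  level₂-≤ b = ≤-trans (newLevel-≤ move₂ level₁ b) (s≤s (level₁-≤ b))

  level₃-≤ : ∀ b → level₃ b ≤ 3
  level₃-≤ b = ≤-trans (newLevel-≤ move₃ level₂ b) (s≤s (level₂-≤ b))

  r0≢r1 : r0 ≢ r1
  r0≢r1 ()
  r2≢r1 : r2 ≢ r1
  r2≢r1 ()

  level₂-r0 : ∀ a → residue a ≡ r2 → level₂ (suc a) ≡ 0
  level₂-r0 a eq rewrite eq = refl

  level₁-r1 : ∀ a → residue a ≡ r1 → level₁ a ≡ 1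
  level₁-r1 (suc a) eq with residue a
  level₁-r1 (suc a) eq | r0 = refl
  level₁-r1 (suc a) () | r1
  level₁-r1 (suc a) () | r2

  valid₀ : Valid (λ _ → free) (λ _ → 0) move₁
  valid₀ = record
    { from-free = λ _ _ → refl
    ; best = best
    ; low = λ _ _ → s≤s z≤n
    ; no-clash = λ {a} _ → no-clash a
    ; maximal = λ _ _ → maximal
    }
    where
    best : ∀ {a} → a < n → Best (λ _ → 0) (move₁ a) a
    best {a} a<n with residue a in eq
    ... | r0 = not-last a<n (subst (_≢ r1) (sym eq) r0≢r1) , z≤n
    ... | r1 = tt
    ... | r2 = λ _ → z≤n
    no-clash : ∀ a → move₁ a ≡ right → move₁ (suc a) ≢ left
    no-clash a _ with residue a
    no-clash a _ | r0 = λ ()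
    maximal : ∀ {a} → move₁ a ≡ free → ∀ s → s ≢ free → Best (λ _ → 0) s a →
      taken move₁ (target s a) ≡ true
    maximal fa free ≢free _ = contradiction refl ≢free
    maximal {a} fa right _ _ with residue a
    maximal {a} _  right _ _ | r1 = refl
    maximal {suc a} fa left _ _ with residue a
    maximal {suc a} _  left _ _ | r0 = refl

  -- The left neighbour of a free vertex has counter 1, the largest value so far, so going right is
  -- minimal. Every free vertex chooses, which settles maximality.
  valid₁ : Valid move₁ level₁ move₂
  valid₁ = record
    { from-free = λ {a} _ → from-free a
    ; best = best
    ; low = λ {a} _ _ → s≤s (≤-trans (level₁-≤ a) (s≤s z≤n))
    ; no-clash = λ {a} _ → no-clash a
    ; maximal = λ {a} _ fa ga → contradiction ga (moves a fa)
    }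
    where
    from-free : ∀ a → move₂ a ≢ free → move₁ a ≡ free
    from-free a ≢free with residue a
    ... | r0 = contradiction refl ≢free
    ... | r1 = refl
    ... | r2 = contradiction refl ≢free
    best : ∀ {a} → a < n → Best level₁ (move₂ a) a
    best {a} a<n with residue a in eq
    ... | r0 = tt
    ... | r2 = tt
    ... | r1 with a ≡ᵇ suc k in last
    ...   | true rewrite ≡ᵇ⇒≡ a (suc k) (subst T (sym last) tt) = λ lt → contradiction lt (<-irrefl refl)
    ...   | false = s≤s (≤∧≢⇒< (s≤s⁻¹ a<n) λ where
                refl → contradiction (trans (sym (≡ᵇ-refl (suc k))) last) (λ ()))
              , ≤-trans (level₁-≤ (suc a)) (≤-reflexive (sym (level₁-r1 a eq)))
    no-clash : ∀ a → move₂ a ≡ right → move₂ (suc a) ≢ left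
    no-clash a _ with residue a
    no-clash a _ | r1 = λ ()
    moves : ∀ a → move₁ a ≡ free → move₂ a ≢ free
    moves a _ with residue a
    moves a _ | r1 with a ≡ᵇ suc k
    ... | true  = λ ()
    ... | false = λ ()

  -- The vertex before it is not the last one, hence went right in round two and took its partner.
  status₂-r2 : ∀ {a} → a < n → residue a ≡ r2 → status₂ a ≡ free
  status₂-r2 {suc a} a<n eq with residue a in eq′
  status₂-r2 {suc a} a<n () | r0
  status₂-r2 {suc a} a<n eq | r1 rewrite eq′ | before-last a<n = refl
  status₂-r2 {suc a} a<n () | r2

  taken₃-r0 : ∀ a → 0 < a → residue a ≡ r0 → taken move₃ a ≡ true
  taken₃-r0 (suc a) _ eq with residue a
  taken₃-r0 (suc a) _ () | r0
  taken₃-r0 (suc a) _ () | r1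
  taken₃-r0 (suc a) _ eq | r2 = refl

  0<k : 0 < k
  0<k = ≤-trans (s≤s z≤n) (*-monoˡ-≤ 3 1≤y)

  level₂-k : level₂ k ≡ 0
  level₂-k with k | 0<k | residue-k
  ... | suc j | _ | eq with residue j
  ...   | r2 = refl

  level₂-last : level₂ (suc k) ≡ 2
  level₂-last rewrite residue-k | ≡ᵇ-refl k = refl

  -- The one idle free vertex is a_k. Its minimal neighbour b_k, with counter 0, goes to a_(k-1),
  -- and b_(k+1) has counter 2, so a_k cannot be matched.
  valid₂ : Valid status₂ level₂ move₃
  valid₂ = record
    { from-free = from-free
    ; best = best
    ; low = λ {a} _ _ → s≤s (≤-trans (level₂-≤ a) (s≤s 0<k))
    ; no-clash = λ {a} _ → no-clash a
    ; maximal = maximal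
    }
    where
    from-free : ∀ {a} → a < n → move₃ a ≢ free → status₂ a ≡ free
    from-free {a} a<n ≢free with residue a in eq
    ... | r0 = contradiction refl ≢free
    ... | r1 = contradiction refl ≢free
    -- The case split has turned `residue a` into `r2` in the goal; the `cong` restores the
    -- unevaluated `status₂ a`.
    ... | r2 = trans
                 (sym (cong (λ r → override (by₂ r (a ≡ᵇ suc k)) (taken move₂ (target (by₁ r) a)) (by₁ r)) eq))
                 (status₂-r2 a<n eq)
    best : ∀ {a} → a < n → Best level₂ (move₃ a) a
    best {a} a<n with residue a in eq
    ... | r0 = tt
    ... | r1 = tt
    ... | r2 = not-last a<n (subst (_≢ r1) (sym eq) r2≢r1)
             , subst (_≤ level₂ a) (sym (level₂-r0 a eq)) z≤n
    no-clash : ∀ a → move₃ a ≡ right → move₃ (suc a) ≢ left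
    no-clash a _ with residue a
    no-clash a _ | r2 = λ ()
    free⇒k : ∀ a → a < n → status₂ a ≡ free → move₃ a ≡ free → a ≡ k
    free⇒k a a<n fa ga with residue a in eq
    free⇒k a a<n fa ga | r0 rewrite eq with a ≡ᵇ k in last
    ... | true  = ≡ᵇ⇒≡ a k (subst T (sym last) tt)
    free⇒k a a<n () ga | r0 | false
    free⇒k a a<n fa ga | r1 with a ≡ᵇ suc k
    free⇒k a a<n () ga | r1 | true
    free⇒k a a<n () ga | r1 | false
    maximal : ∀ {a} → a < n → status₂ a ≡ free → move₃ a ≡ free → ∀ s → s ≢ free →
      Best level₂ s a → taken move₃ (target s a) ≡ true
    maximal {a} a<n fa ga s s≢ bst with refl ← free⇒k a a<n fa ga with s | bst
    ... | free  | _ = contradiction refl s≢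
    ... | left  | _ = taken₃-r0 k 0<k residue-k
    ... | right | _ , le rewrite level₂-k | level₂-last = contradiction le λ ()

  -- Handover to the walk: below k each vertex took its right edge in round one, two or three,
  -- according to its residue; a_k lost b_(k+1) to the last vertex in round two.
  status₃ : ∀ {a} → a < n → tokenStatus (suc k) a ≡ newStatus move₃ status₂ a
  status₃ {a} (s≤s a≤1+k) with <-cmp a k
  ... | tri< a<k _ _ = trans (tokenStatus-right {suc k} (s≤s a<k)) (sym lemma)
    where
    lemma : newStatus move₃ status₂ a ≡ right
    lemma with residue a in eq
    ... | r0 rewrite eq | ≢⇒≡ᵇ (<⇒≢ a<k) | eq = refl
    ... | r1 rewrite ≢⇒≡ᵇ (<⇒≢ (m<n⇒m<1+n a<k)) | eq = refl
    ... | r2 = refl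
  ... | tri≈ _ refl _ = trans (tokenStatus-free a) (sym lemma)
    where
    lemma : newStatus move₃ status₂ k ≡ free
    lemma rewrite residue-k | ≡ᵇ-refl k | residue-k = keep-free (taken move₃ k)
  ... | tri> _ _ k<a with refl ← ≤-antisym a≤1+k k<a = trans (tokenStatus-left {suc k} ≤-refl) (sym lemma)
    where
    lemma : newStatus move₃ status₂ (suc k) ≡ left
    lemma rewrite residue-k | ≡ᵇ-refl k | residue-k = refl

  start-invariant : Invariant start
  start-invariant = record
    { inside = n≤1+n _
    ; low = low
    -- Only b_(k+1) lies to the right of a_k, so there is no pair to compare.
    ; monotone = λ le lt → contradiction (≤-trans lt (s≤s le)) (<-irrefl refl)
    ; parityLeft = parityLeft
    ; parityRight = parityRight
    }
    where
    low : ∀ {i} → i < suc k → level₃ i ≤ i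
    low {zero} _ = z≤n
    low {suc i} (s≤s i<k) with residue i in eq
    ... | r0 rewrite ≢⇒≡ᵇ (<⇒≢ i<k) = s≤s z≤n
    ... | r2 = s≤s z≤n
    low {suc zero} (s≤s i<k) | r1 = contradiction eq r0≢r1
    low {suc (suc i)} (s≤s i<k) | r1 rewrite ≢⇒≡ᵇ (<⇒≢ (<⇒≤ i<k)) = s≤s (s≤s z≤n)
    parityLeft : ∀ {i} → 0 < i → i < suc k → isOdd (level₃ i) ≡ oddBefore (residue i)
    parityLeft {suc i} _ (s≤s i<k) with residue i
    ... | r0 rewrite ≢⇒≡ᵇ (<⇒≢ i<k) = refl
    ... | r1 rewrite ≢⇒≡ᵇ (<⇒≢ (m<n⇒m<1+n i<k)) = refl
    ... | r2 = refl
    parityRight : ∀ {i} → 0 < i → suc k ≤ i → i < n → isOdd (level₃ i) ≡ not (oddBefore (residue i))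
    parityRight {i} _ k<i (s≤s i≤1+k) with refl ← ≤-antisym i≤1+k k<i
      rewrite residue-k | ≡ᵇ-refl k = refl

  schedule : Schedule n
  schedule = record
    { f = f ; lv = lv ; g = g
    ; f₀ = λ _ → refl ; lv₀ = λ _ → refl
    ; valid = valid
    ; fₛ = fₛ
    ; lvₛ = lvₛ
    }
    where
    rotor : ℕ → Config
    rotor r = iterate r start
    f : ℕ → ℕ → Status
    f 0 _ = free
    f 1 = move₁
    f 2 = status₂
    f (suc (suc (suc r))) = tokenStatus (Config.position (rotor r))
    lv : ℕ → ℕ → ℕ
    lv 0 _ = 0
    lv 1 = level₁
    lv 2 = level₂
    lv (suc (suc (suc r))) = Config.levels (rotor r)
    g : ℕ → ℕ → Status
    g 0 = move₁
    g 1 = move₂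
    g 2 = move₃
    g (suc (suc (suc r))) = move (rotor r)
    valid : ∀ r → Valid (f r) (lv r) (g r)
    valid 0 = valid₀
    valid 1 = valid₁
    valid 2 = valid₂
    valid (suc (suc (suc r))) = move-valid (iterate-invariant r start-invariant)
    fₛ : ∀ r {a} → a < n → f (suc r) a ≡ newStatus (g r) (f r) a
    fₛ 0 {a} _ with residue a
    ... | r0 = refl
    ... | r2 = refl
    ... | r1 = sym (keep-free (taken move₁ a))
    fₛ 1 _ = refl
    fₛ 2 = status₃
    fₛ (suc (suc (suc r))) {a} _ = advance-status (rotor r) a
    lvₛ : ∀ r {b} → b < n → lv (suc r) b ≡ newLevel (g r) (lv r) b
    lvₛ 0 _ = refl
    lvₛ 1 _ = refl
    lvₛ 2 _ = refl
    lvₛ (suc (suc (suc r))) {b} _ = advance-levels (rotor r) b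

  schedule-free : 6 ≤ y → ∀ r → r < y * y → ∃ λ a → a < n × Schedule.f schedule r a ≡ free
  schedule-free _ 0 _ = 0 , s≤s z≤n , refl
  -- a_1 is idle in round one, and a_2 is displaced in round two.
  schedule-free _ 1 _ = 1 , s≤s (s≤s z≤n) , refl
  schedule-free _ 2 _ = 2 , s≤s (s≤s 0<k) , status₂-r2 (s≤s (s≤s 0<k)) refl
  -- Three rounds belong to the opening, so the walk has made r moves.
  schedule-free 6≤y (suc (suc (suc r))) r<y²
    with iterate r start | iterate-invariant r start-invariant
       | slow y 6≤y (n≤1+n (suc k)) {start} level₃-≤ start-invariant r (≤-trans (m≤n+m _ 3) r<y²)
  ... | lv at zero  | _   | p≢0 = contradiction refl p≢0
  ... | lv at suc t | inv | _   = t , Invariant.inside inv , tokenStatus-free t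

-- Slow executions on the path and the size of a maximum matching.

slowLine : ∀ {n} y → 6 ≤ y → n ≡ 2 + y * 3 → ∀ v → (∀ k → k < n → NotFrozen v k) →
  let open ALT (Line.line n) v in
  ∃ λ (N : ℕ → EdgeSet n n) → IsExecution N × ∀ r → r < y * y → length (matchingAfter N r) < n
slowLine y 6≤y refl v notFrozen =
  scheduled schedule v notFrozen , scheduled-execution schedule v notFrozen ,
  λ r r<y² → let a , a<n , fa = schedule-free 6≤y r r<y² in
    scheduled-deficient schedule v notFrozen r a<n fa
  where open Opening y (≤-trans (s≤s z≤n) 6≤y)

module _ where
  open Line

  -- The edges a_i b_i form a perfect matching.
  line-maximum : ∀ {n} OPT → IsMaximum (line n) OPT → length OPT ≡ n
  line-maximum {n} OPT ((_ , dis) , max) = ≤-antisym (matching-length≤ dis)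
    (subst (_≤ length OPT) (trans (length-map diagonal (allFin n)) (length-tabulate (λ i → i)))
      (max (map diagonal (allFin n))
        ( Allₚ.map⁺ (All.universal (λ _ → inj₁ refl) (allFin n))
        , AllPairsₚ.map⁺ (AllPairs.map (λ i≢j → i≢j , i≢j) (Uniqueₚ.allFin⁺ n)))))
    where
    diagonal : Fin n → Fin n × Fin n
    diagonal i = i , i

-- Natural numbers as rationals, and an Archimedean choice.

ι : ℕ → ℚ
ι k = + k ℚ./ 1

-- Normalised fractions do not reduce for a variable k, so facts about `ι` are proved in the
-- unnormalised rationals and carried back.
ιᵘ : ∀ k → toℚᵘ (ι k) ≃ mkℚᵘ (+ k) 0
ιᵘ k = ℚₚ.toℚᵘ-fromℚᵘ (mkℚᵘ (+ k) 0)

ι-mono : ∀ {k l} → k ≤ l → ι k ℚ.≤ ι l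
ι-mono {k} {l} k≤l = ℚₚ.toℚᵘ-cancel-≤ (begin
  toℚᵘ (ι k)     ≃⟨ ιᵘ k ⟩
  mkℚᵘ (+ k) 0   ≤⟨ *≤* (ℤₚ.*-monoʳ-≤-nonNeg (+ 1) (ℤ.+≤+ k≤l)) ⟩
  mkℚᵘ (+ l) 0   ≃⟨ ιᵘ l ⟨
  toℚᵘ (ι l)     ∎)
  where open ℚᵘₚ.≤-Reasoning

ι-+ : ∀ k l → ι (k + l) ≡ ι k ℚ.+ ι l
ι-+ k l = ℚₚ.toℚᵘ-injective (begin
  toℚᵘ (ι (k + l))                    ≈⟨ ιᵘ (k + l) ⟩
  mkℚᵘ (+ (k + l)) 0                  ≈⟨ *≡* (cong (ℤ._* + 1)
                                           (cong₂ ℤ._+_ (ℤₚ.*-identityʳ (+ k)) (ℤₚ.*-identityʳ (+ l)))) ⟨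
  mkℚᵘ (+ k) 0 ℚᵘ.+ mkℚᵘ (+ l) 0      ≈⟨ ℚᵘₚ.+-cong (ιᵘ k) (ιᵘ l) ⟨
  toℚᵘ (ι k) ℚᵘ.+ toℚᵘ (ι l)          ≈⟨ ℚₚ.toℚᵘ-homo-+ (ι k) (ι l) ⟨
  toℚᵘ (ι k ℚ.+ ι l)                  ∎)
  where open import Relation.Binary.Reasoning.Setoid ℚᵘₚ.≃-setoid

ι-* : ∀ k l → ι (k * l) ≡ ι k ℚ.* ι l
ι-* k l = ℚₚ.toℚᵘ-injective (begin
  toℚᵘ (ι (k * l))                    ≈⟨ ιᵘ (k * l) ⟩
  mkℚᵘ (+ (k * l)) 0                  ≈⟨ *≡* (cong (ℤ._* + 1) (ℤₚ.pos-* k l)) ⟩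
  mkℚᵘ (+ k) 0 ℚᵘ.* mkℚᵘ (+ l) 0      ≈⟨ ℚᵘₚ.*-cong (ιᵘ k) (ιᵘ l) ⟨
  toℚᵘ (ι k) ℚᵘ.* toℚᵘ (ι l)          ≈⟨ ℚₚ.toℚᵘ-homo-* (ι k) (ι l) ⟨
  toℚᵘ (ι k ℚ.* ι l)                  ∎)
  where open import Relation.Binary.Reasoning.Setoid ℚᵘₚ.≃-setoid

ι-nonNegative : ∀ k → ℚ.NonNegative (ι k)
ι-nonNegative k = ℚ.nonNegative (ι-mono {0} {k} z≤n)

ι*ᵘ : ∀ k u → toℚᵘ (ι k ℚ.* u) ≃ mkℚᵘ (+ k) 0 ℚᵘ.* toℚᵘ u
ι*ᵘ k u = ℚᵘₚ.≃-trans (ℚₚ.toℚᵘ-homo-* (ι k) u) (ℚᵘₚ.*-congʳ {toℚᵘ u} (ιᵘ k))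

-- With u = (p+1)/(d+1), x is the integer part of 1/(u(m+1)), found by dividing natural numbers.
archimedean : ∀ u → Positive u → ∀ m → ∃ λ x →
  ι x ℚ.* u ℚ.≤ + 1 ℚ./ suc m × + 1 ℚ./ suc m ℚ.≤ ι (suc x) ℚ.* u
archimedean u@(mkℚ +[1+ p ] d _) _ m = x , ℚₚ.toℚᵘ-cancel-≤ lower , ℚₚ.toℚᵘ-cancel-≤ upper
  where
  open ℚᵘₚ.≤-Reasoning
  P = suc p * suc m
  x = suc d / P
  d≤ : suc d ≤ suc x * P
  d≤ = subst (_≤ suc x * P) (sym (m≡m%n+[m/n]*n (suc d) P))
    (+-monoˡ-≤ (x * P) (<⇒≤ (m%n<n (suc d) P)))
  1/ᵘ : toℚᵘ (+ 1 ℚ./ suc m) ≃ mkℚᵘ (+ 1) m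
  1/ᵘ = ℚₚ.toℚᵘ-fromℚᵘ (mkℚᵘ (+ 1) m)
  -- The two sides after clearing denominators, in the form to which the unnormalised inequality
  -- unfolds.
  lhs : ∀ k → + (k * P) ≡ (+ k ℤ.* +[1+ p ]) ℤ.* + suc m
  lhs k = trans (cong +_ (sym (*-assoc k (suc p) (suc m))))
    (trans (ℤₚ.pos-* (k * suc p) (suc m)) (cong (ℤ._* + suc m) (ℤₚ.pos-* k (suc p))))
  rhs : + suc d ≡ + 1 ℤ.* + suc (d + 0 * suc d)
  rhs = trans (cong (+_ ∘ suc) (sym (+-identityʳ d))) (sym (ℤₚ.*-identityˡ _))
  lower : toℚᵘ (ι x ℚ.* u) ℚᵘ.≤ toℚᵘ (+ 1 ℚ./ suc m)
  lower = begin
    toℚᵘ (ι x ℚ.* u)                ≃⟨ ι*ᵘ x u ⟩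
    mkℚᵘ (+ x) 0 ℚᵘ.* toℚᵘ u        ≤⟨ *≤* (subst₂ ℤ._≤_ (lhs x) rhs (ℤ.+≤+ (m/n*n≤m (suc d) P))) ⟩
    mkℚᵘ (+ 1) m                    ≃⟨ 1/ᵘ ⟨
    toℚᵘ (+ 1 ℚ./ suc m)            ∎
  upper : toℚᵘ (+ 1 ℚ./ suc m) ℚᵘ.≤ toℚᵘ (ι (suc x) ℚ.* u)
  upper = begin
    toℚᵘ (+ 1 ℚ./ suc m)            ≃⟨ 1/ᵘ ⟩
    mkℚᵘ (+ 1) m                    ≤⟨ *≤* (subst₂ ℤ._≤_ rhs (lhs (suc x)) (ℤ.+≤+ d≤)) ⟩
    mkℚᵘ (+ suc x) 0 ℚᵘ.* toℚᵘ u    ≃⟨ ι*ᵘ (suc x) u ⟨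
    toℚᵘ (ι (suc x) ℚ.* u)          ∎

-- Numerical estimates.

open CommutativeSemigroupProperties (CommutativeMonoid.commutativeSemigroup ℚₚ.*-1-commutativeMonoid)
  using (interchange)

_/ℚ_ : ℕ → (d : ℕ) → .{{_ : NonZero d}} → ℚ
p /ℚ d = + p ℚ./ d

*-mono-≤-nonNeg : ∀ {p q r s} → ℚ.NonNegative p → ℚ.NonNegative r →
  p ℚ.≤ q → r ℚ.≤ s → p ℚ.* r ℚ.≤ q ℚ.* s
*-mono-≤-nonNeg {p} {q} {r} {s} 0≤p 0≤r p≤q r≤s = ℚₚ.≤-trans
  (ℚₚ.*-monoˡ-≤-nonNeg p {{0≤p}} r≤s)
  (ℚₚ.*-monoʳ-≤-nonNeg s {{ℚ.nonNegative (ℚₚ.≤-trans (ℚₚ.nonNegative⁻¹ r {{0≤r}}) r≤s)}} p≤q)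

module _ {x : ℕ} {u : ℚ} (0≤u : ℚ.NonNegative u) where

  -- The two factors 3 give 9/12 = 3/4. Being below 1, this bound serves for the deficiency as well
  -- as for freezing.
  three-quarters : ι x ℚ.* u ℚ.≤ 1 /ℚ 12 → ∀ {k e} → k ≤ 3 * x →
    ℚ.NonNegative e → e ℚ.≤ ι 3 ℚ.* u → ι k ℚ.* e ℚ.≤ 3 /ℚ 4
  three-quarters xu≤ {k} {e} k≤3x 0≤e e≤3u = begin
    ι k ℚ.* e                           ≤⟨ *-mono-≤-nonNeg (ι-nonNegative k) 0≤e (ι-mono {k} {3 * x} k≤3x) e≤3u ⟩
    ι (3 * x) ℚ.* (ι 3 ℚ.* u)           ≡⟨ cong (ℚ._* (ι 3 ℚ.* u)) (ι-* 3 x) ⟩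
    (ι 3 ℚ.* ι x) ℚ.* (ι 3 ℚ.* u)       ≡⟨ interchange (ι 3) (ι x) (ι 3) u ⟩
    (ι 3 ℚ.* ι 3) ℚ.* (ι x ℚ.* u)       ≤⟨ ℚₚ.*-monoˡ-≤-nonNeg (ι 3 ℚ.* ι 3) xu≤ ⟩
    (ι 3 ℚ.* ι 3) ℚ.* (1 /ℚ 12)         ≡⟨⟩
    3 /ℚ 4                              ∎
    where open ℚₚ.≤-Reasoning

  -- Used contrapositively, to get r < y² from r ε² ≤ C; 576 is the square of 24.
  square-large : ∀ {y r e} → 1 /ℚ 12 ℚ.≤ ι (2 * y) ℚ.* u → y * y ≤ r → u ℚ.≤ e →
    1 /ℚ 576 ℚ.≤ ι r ℚ.* (e ℚ.* e)
  square-large {y} {r} {e} ≤2yu y²≤r u≤e = begin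
    1 /ℚ 576                            ≡⟨⟩
    (1 /ℚ 24) ℚ.* (1 /ℚ 24)             ≤⟨ *-mono-≤-nonNeg _ _ 1/24≤ 1/24≤ ⟩
    (ι y ℚ.* u) ℚ.* (ι y ℚ.* u)         ≡⟨ interchange (ι y) u (ι y) u ⟩
    (ι y ℚ.* ι y) ℚ.* (u ℚ.* u)         ≡⟨ cong (ℚ._* (u ℚ.* u)) (ι-* y y) ⟨
    ι (y * y) ℚ.* (u ℚ.* u)             ≤⟨ *-mono-≤-nonNeg (ι-nonNegative (y * y)) u²
                                             (ι-mono {y * y} {r} y²≤r) (*-mono-≤-nonNeg 0≤u 0≤u u≤e u≤e) ⟩
    ι r ℚ.* (e ℚ.* e)                   ∎
    where
    open ℚₚ.≤-Reasoning
    u² : ℚ.NonNegative (u ℚ.* u)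
    u² = ℚₚ.nonNeg*nonNeg⇒nonNeg u {{0≤u}} u {{0≤u}}
    1/24≤ : 1 /ℚ 24 ℚ.≤ ι y ℚ.* u
    1/24≤ = ℚₚ.*-cancelˡ-≤-pos (ι 2) (begin
      ι 2 ℚ.* (1 /ℚ 24)                 ≡⟨⟩
      1 /ℚ 12                           ≤⟨ ≤2yu ⟩
      ι (2 * y) ℚ.* u                   ≡⟨ cong (ℚ._* u) (ι-* 2 y) ⟩
      (ι 2 ℚ.* ι y) ℚ.* u               ≡⟨ ℚₚ.*-assoc (ι 2) (ι y) u ⟩
      ι 2 ℚ.* (ι y ℚ.* u)               ∎)

-- One missing edge exceeds the permitted loss o e ≤ 3/4 by 1/4, the uniform gap that `_<ℝ_` asks
-- for.
deficiency-gap : ∀ {l o e} → suc l ≤ o → ι o ℚ.* e ℚ.≤ 3 /ℚ 4 →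
  ι l ℚ.+ 1 /ℚ 4 ℚ.≤ (ι 1 ℚ.- e) ℚ.* ι o
deficiency-gap {l} {o} {e} l<o oe≤ = begin
  ι l ℚ.+ 1 /ℚ 4                        ≡⟨⟩
  ι l ℚ.+ (ι 1 ℚ.- 3 /ℚ 4)              ≡⟨ ℚₚ.+-assoc (ι l) (ι 1) (ℚ.- (3 /ℚ 4)) ⟨
  (ι l ℚ.+ ι 1) ℚ.- 3 /ℚ 4              ≡⟨ cong (ℚ._- 3 /ℚ 4) (ι-+ l 1) ⟨
  ι (l + 1) ℚ.- 3 /ℚ 4                  ≤⟨ ℚₚ.+-mono-≤ (ι-mono {l + 1} {o} (subst (_≤ o) (+-comm 1 l) l<o))
                                             (ℚₚ.neg-antimono-≤ oe≤) ⟩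
  ι o ℚ.- ι o ℚ.* e                     ≡⟨ cong₂ ℚ._+_ (sym (ℚₚ.*-identityʳ (ι o))) (ℚₚ.neg-distribʳ-* (ι o) e) ⟩
  ι o ℚ.* ι 1 ℚ.+ ι o ℚ.* (ℚ.- e)       ≡⟨ ℚₚ.*-distribˡ-+ (ι o) (ι 1) (ℚ.- e) ⟨
  ι o ℚ.* (ι 1 ℚ.- e)                   ≡⟨ ℚₚ.*-comm (ι o) (ι 1 ℚ.- e) ⟩
  (ι 1 ℚ.- e) ℚ.* ι o                   ∎
  where open ℚₚ.≤-Reasoning

-- Rational bounds for a positive real.

p≤∣p∣ : ∀ p → p ℚ.≤ ℚ.∣ p ∣
p≤∣p∣ p = [ (λ 0≤p → ℚₚ.≤-reflexive (sym (ℚₚ.0≤p⇒∣p∣≡p 0≤p)))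
          , (λ p≤0 → ℚₚ.≤-trans p≤0 (ℚₚ.0≤∣p∣ p)) ]′ (ℚₚ.≤-total 0ℚ p)

-- u is half of a late term e. From there on terms differ by at most δ/2 ≤ u, so they stay between e
-- - u = u and e + u = 3u.
approximate : ∀ ε → fromℕ 0 <ℝ ε → ε ≤ℝ fromℚ (1 /ℚ 200) →
  ∃ λ u → Positive u × u ℚ.≤ 1 /ℚ 200 ×
  ∃ λ N → ∀ n → N ≤ n → u ℚ.≤ seq ε n × seq ε n ℚ.≤ ι 3 ℚ.* u
approximate ε (δ , 0<δ , N₁ , δ≤ε) ε≤ = u , ℚ.positive 0<u , u≤ , N , bounds
  where
  0<½δ : 0ℚ ℚ.< ½ ℚ.* δ
  0<½δ = ℚₚ.positive⁻¹ (½ ℚ.* δ) {{ℚₚ.pos*pos⇒pos ½ δ {{ℚ.positive 0<δ}}}}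
  -- With tolerance 1/200 the term e is at most 1/100, and halving it brings u down to 1/200.
  N₂ = proj₁ (ε≤ (1 /ℚ 200) (ℚₚ.positive⁻¹ (1 /ℚ 200)))
  N₃ = proj₁ (cauchy ε (½ ℚ.* δ) 0<½δ)
  N = N₁ ⊔ (N₂ ⊔ N₃)
  e u : ℚ
  e = seq ε N
  u = ½ ℚ.* e
  δ≤e : δ ℚ.≤ e
  δ≤e = subst (ℚ._≤ e) (ℚₚ.+-identityˡ δ) (δ≤ε N (m≤m⊔n N₁ _))
  ½δ≤u : ½ ℚ.* δ ℚ.≤ u
  ½δ≤u = ℚₚ.*-monoˡ-≤-nonNeg ½ δ≤e
  0<u : 0ℚ ℚ.< u
  0<u = ℚₚ.<-≤-trans 0<½δ ½δ≤u
  u≤ : u ℚ.≤ 1 /ℚ 200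
  u≤ = ℚₚ.*-monoˡ-≤-nonNeg ½ (proj₂ (ε≤ (1 /ℚ 200) (ℚₚ.positive⁻¹ (1 /ℚ 200))) N
    (≤-trans (m≤m⊔n N₂ N₃) (m≤n⊔m N₁ _)))
  e≡u+u : e ≡ u ℚ.+ u
  e≡u+u = trans (sym (ℚₚ.*-identityˡ e)) (ℚₚ.*-distribʳ-+ e ½ ½)
  close : ∀ {m n} → N ≤ m → N ≤ n → seq ε m ℚ.- seq ε n ℚ.≤ u
  close {m} {n} N≤m N≤n = ℚₚ.≤-trans (p≤∣p∣ _) (ℚₚ.≤-trans
    (proj₂ (cauchy ε (½ ℚ.* δ) 0<½δ) m n (≤-trans N₃≤N N≤m) (≤-trans N₃≤N N≤n)) ½δ≤u)
    where
    N₃≤N : N₃ ≤ N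
    N₃≤N = ≤-trans (m≤n⊔m N₂ N₃) (m≤n⊔m N₁ _)
  bounds : ∀ n → N ≤ n → u ℚ.≤ seq ε n × seq ε n ℚ.≤ ι 3 ℚ.* u
  bounds n N≤n = below , above
    where
    open ℚₚ.≤-Reasoning
    z = seq ε n
    cancel : ∀ p q → (p ℚ.- q) ℚ.+ q ≡ p
    cancel p q = trans (ℚₚ.+-assoc p (ℚ.- q) q)
      (trans (cong (p ℚ.+_) (ℚₚ.+-inverseˡ q)) (ℚₚ.+-identityʳ p))
    below : u ℚ.≤ z
    below = ℚₚ.≮⇒≥ λ z<u → ℚₚ.<-irrefl refl (ℚₚ.<-≤-trans (ℚₚ.+-monoʳ-< u z<u) (begin
      u ℚ.+ u                 ≡⟨ e≡u+u ⟨
      e                       ≡⟨ cancel e z ⟨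
      (e ℚ.- z) ℚ.+ z         ≤⟨ ℚₚ.+-monoˡ-≤ z (close ≤-refl N≤n) ⟩
      u ℚ.+ z                 ∎))
    above : z ℚ.≤ ι 3 ℚ.* u
    above = begin
      z                       ≡⟨ cancel z e ⟨
      (z ℚ.- e) ℚ.+ e         ≤⟨ ℚₚ.+-mono-≤ (close N≤n ≤-refl) (ℚₚ.≤-reflexive e≡u+u) ⟩
      u ℚ.+ (u ℚ.+ u)         ≡⟨ cong₂ ℚ._+_ (ℚₚ.*-identityˡ u)
                                   (cong₂ ℚ._+_ (ℚₚ.*-identityˡ u) (ℚₚ.*-identityˡ u)) ⟨
      ι 1 ℚ.* u ℚ.+ (ι 1 ℚ.* u ℚ.+ ι 1 ℚ.* u) ≡⟨ cong (ι 1 ℚ.* u ℚ.+_) (ℚₚ.*-distribʳ-+ u (ι 1) (ι 1)) ⟨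
      ι 1 ℚ.* u ℚ.+ ι 2 ℚ.* u ≡⟨ ℚₚ.*-distribʳ-+ u (ι 1) (ι 2) ⟨
      ι 3 ℚ.* u               ∎

-- The choice of x and of the constants.

length-path : ∀ y → 3 * suc y ∸ 1 ≡ 2 + y * 3
length-path y = cong (_∸ 1) (*-comm 3 (suc y))

module SlowPath (ε : ℝ) {u : ℚ} (u>0 : Positive u) {N₀ : ℕ}
  (bounds : ∀ n → N₀ ≤ n → u ℚ.≤ seq ε n × seq ε n ℚ.≤ ι 3 ℚ.* u)
  (y : ℕ) (6≤y : 6 ≤ y)
  (small : ι (suc y) ℚ.* u ℚ.≤ 1 /ℚ 12) (large : 1 /ℚ 12 ℚ.≤ ι (2 + y) ℚ.* u) where

  n : ℕ
  n = 3 * suc y ∸ 1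

  0≤u : ℚ.NonNegative u
  0≤u = ℚₚ.pos⇒nonNeg u {{u>0}}

  0≤ε : ∀ {j} → N₀ ≤ j → ℚ.NonNegative (seq ε j)
  0≤ε N₀≤j = ℚ.nonNegative (ℚₚ.≤-trans (ℚₚ.nonNegative⁻¹ u {{0≤u}}) (proj₁ (bounds _ N₀≤j)))

  ε-small : ∀ {k} → k ≤ n → ∀ {j} → N₀ ≤ j → ι k ℚ.* seq ε j ℚ.≤ 3 /ℚ 4
  ε-small {k} k≤n {j} N₀≤j =
    three-quarters {suc y} 0≤u small {k} {seq ε j} (≤-trans k≤n (m∸n≤m _ 1))
      (0≤ε N₀≤j) (proj₂ (bounds _ N₀≤j))

  rounds : ∀ r → fromℕ r *ℝ (ε *ℝ ε) ≤ℝ fromℚ (1 /ℚ 1000) → r < y * y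
  rounds r rε²≤C = ≰⇒> λ y²≤r → ℚₚ.<-irrefl refl (ℚₚ.<-≤-trans
    -- C plus the tolerance 1/2000 at which `_≤ℝ_` is applied is 3/2000, still below 1/576.
    (toWitness {a? = 1 /ℚ 1000 ℚ.+ 1 /ℚ 2000 ℚ.<? 1 /ℚ 576} _)
    (ℚₚ.≤-trans (square-large {y} 0≤u {y} {r} {seq ε j} large′ y²≤r (proj₁ (bounds j (m≤m⊔n N₀ (proj₁ at)))))
      (proj₂ at j (m≤n⊔m N₀ (proj₁ at)))))
    where
    at = rε²≤C (1 /ℚ 2000) (ℚₚ.positive⁻¹ (1 /ℚ 2000))
    j = N₀ ⊔ proj₁ at
    large′ : 1 /ℚ 12 ℚ.≤ ι (2 * y) ℚ.* u
    large′ = ℚₚ.≤-trans large (ℚₚ.*-monoʳ-≤-nonNeg u {{0≤u}} (ι-mono {2 + y} {2 * y} 2+y≤2y))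
      where
      2+y≤2y : 2 + y ≤ 2 * y
      2+y≤2y = +-mono-≤ (≤-trans (s≤s (s≤s z≤n)) 6≤y) (≤-reflexive (sym (+-identityʳ y)))

  slow-path : ∀ v → (∀ k → k < n → NotFrozen v k) → SlowExecution (path (suc y)) v (fromℚ (1 /ℚ 1000)) ε
  slow-path v notFrozen = N , execution , λ r rε²≤C OPT maximum →
    1 /ℚ 4 , ℚₚ.positive⁻¹ (1 /ℚ 4) , N₀ , λ j N₀≤j →
      let o≡n = line-maximum OPT maximum in
      deficiency-gap {length (matchingAfter N r)} {length OPT} {seq ε j}
        (subst (length (matchingAfter N r) <_) (sym o≡n) (deficient r (rounds r rε²≤C)))
        (ε-small {length OPT} (≤-reflexive o≡n) N₀≤j)
    where
    open ALT (path (suc y)) v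
    run = slowLine y 6≤y (length-path y) v notFrozen
    N = proj₁ run
    execution = proj₁ (proj₂ run)
    deficient = proj₂ (proj₂ run)

  not-frozen : ∀ k → k < n → NotFrozen (withFreezing ε) k
  not-frozen k k<n δ 0<δ = N₀ , λ j N₀≤j → ℚₚ.≤-trans (ε-small {k} (<⇒≤ k<n) N₀≤j)
    (ℚₚ.≤-trans (toWitness {a? = 3 /ℚ 4 ℚ.≤? ι 3 ℚ.+ 0ℚ} _) (ℚₚ.+-monoʳ-≤ (ι 3) (ℚₚ.<⇒≤ 0<δ)))

-- Otherwise (x+1)u ≤ 7/200 < 1/12. The bound 7 provides the 6 ≤ y that `slow` needs for x = y + 1.
large-x : ∀ {u x} → ℚ.NonNegative u → u ℚ.≤ 1 /ℚ 200 → 1 /ℚ 12 ℚ.≤ ι (suc x) ℚ.* u → 7 ≤ x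
large-x {u} {x} 0≤u u≤ large = ≮⇒≥ λ x<7 → ℚₚ.<-irrefl refl (ℚₚ.<-≤-trans
  (toWitness {a? = ι 7 ℚ.* (1 /ℚ 200) ℚ.<? 1 /ℚ 12} _)
  (ℚₚ.≤-trans large (*-mono-≤-nonNeg (ι-nonNegative (suc x)) 0≤u (ι-mono {suc x} {7} x<7) u≤)))

slowPaths : ∀ ε {u} → Positive u →
  ∀ {N₀} → (∀ n → N₀ ≤ n → u ℚ.≤ seq ε n × seq ε n ℚ.≤ ι 3 ℚ.* u) →
  ∀ x → 7 ≤ x → ι x ℚ.* u ℚ.≤ 1 /ℚ 12 → 1 /ℚ 12 ℚ.≤ ι (suc x) ℚ.* u →
  ∃ λ x → 2 ≤ x ×
    SlowExecution (path x) withoutFreezing (fromℚ (1 /ℚ 1000)) ε ×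
    SlowExecution (path x) (withFreezing ε) (fromℚ (1 /ℚ 1000)) ε
slowPaths ε {u} u>0 bounds (suc y) (s≤s 6≤y) small large =
  suc y , s≤s (≤-trans (s≤s z≤n) 6≤y) ,
  slow-path withoutFreezing (λ _ _ → _) , slow-path (withFreezing ε) not-frozen
  where open SlowPath ε u>0 bounds y 6≤y small large

corollary5 : ∃ λ (C : ℝ) → ∃ λ (ε₀ : ℝ) → fromℕ 0 <ℝ C × fromℕ 0 <ℝ ε₀ ×
    (∀ (ε : ℝ) → fromℕ 0 <ℝ ε → ε ≤ℝ ε₀ →
    ∃ λ (x : ℕ) → 2 ≤ x ×
    SlowExecution (path x) withoutFreezing C ε ×
    SlowExecution (path x) (withFreezing ε) C ε)
-- C = 1/1000 stays clear of 1/576 in `rounds`, and ε₀ = 1/200 is what `large-x` needs.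
corollary5 = fromℚ (1 /ℚ 1000) , fromℚ (1 /ℚ 200) , positive (1 /ℚ 1000) , positive (1 /ℚ 200) , slow
  where
  positive : ∀ q .{{_ : Positive q}} → fromℕ 0 <ℝ fromℚ q
  positive q = q , ℚₚ.positive⁻¹ q , 0 , λ _ _ → ℚₚ.≤-reflexive (ℚₚ.+-identityˡ q)
  slow : ∀ ε → fromℕ 0 <ℝ ε → ε ≤ℝ fromℚ (1 /ℚ 200) → ∃ λ x → 2 ≤ x ×
    SlowExecution (path x) withoutFreezing (fromℚ (1 /ℚ 1000)) ε ×
    SlowExecution (path x) (withFreezing ε) (fromℚ (1 /ℚ 1000)) ε
  slow ε 0<ε ε≤ =
    let u , u>0 , u≤ , _ , bounds = approximate ε 0<ε ε≤
        -- The argument 11 encodes the bound 1/12, so x is about 1/(12u) and 3x · 3u ≤ 3/4.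
        x , small , large = archimedean u u>0 11
    in slowPaths ε u>0 bounds x (large-x {u} {x} (ℚₚ.pos⇒nonNeg u {{u>0}}) u≤ large) small large
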